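{- For $m=5$ machines, consider the two-solution ordinal algorithm with the following two solutions. First solution: machine $1$ gets $\{10k+1:k\ge 0\}$; machine $2$ gets $\{10k+2:k\ge 0\}$; machine $3$ gets $\{5k+3:k\ge 0\}$; machine $4$ gets $\{10k+4:k\ge 0\}\cup\{10k+7:k\ge 0\}\cup\{10k:k\ge 1\}$; machine $5$ gets $\{10k+5:k\ge 0\}\cup\{10k+6:k\ge 0\}\cup\{10k+9:k\ge 0\}$. Second solution: machine $1$ gets $\{1\}\cup\{5k:k\ge 2\}$; machine $2$ gets $\{2\}\cup\{5k-1:k\ge 2\}$; machine $3$ gets $\{5k-2:k\ge 1\}$; machine $4$ gets $\{4\}\cup\{5k-3:k\ge 2\}$; machine $5$ gets $\{5\}\cup\{5k-4:k\ge 2\}$. The competitive ratio of this algorithm is at most $1.4$.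
   Context: Ordinal makespan scheduling on $m$ identical machines. Jobs are indexed by positive integers. A realization is a sequence of real job sizes $p_1\ge p_2\ge p_3\ge\cdots\ge 0$ with only finitely many positive sizes. A solution is a partition of the set of all positive integers into $m$ sets $J_1,\dots,J_m$, where $J_i$ is the set of jobs assigned to machine $i$; it is fixed without knowledge of the realization. For a realization, the load of machine $i$ in the solution is $\sum_{j\in J_i}p_j$, and the completion time of the solution is the maximum load of any machine. A two-solution ordinal algorithm consists of two solutions; its makespan for a realization is the minimum of the completion times of its two solutions for that realization. The optimal offline completion time $\lambda$ of a realization is the minimum completion time over all solutions (chosen with full knowledge of the realization). The competitive ratio of the algorithm is the supremum, over all realizations with $\lambda>0$, of the ratio between its makespan and $\lambda$. -}

module Defs where

open import Data.Bool using (if_then_else_)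
open import Data.Fin using (Fin)
import Data.Fin as Fin
open import Data.Fin.Patterns using (0F; 1F; 2F; 3F; 4F)
open import Data.Nat using (ℕ; zero; suc; _≤_; NonZero; z≤n; s≤s; _⊔_)
  renaming (_<_ to _<ℕ_; _+_ to _+ℕ_; _*_ to _*ℕ_; _∸_ to _∸ℕ_)
import Data.Nat.Properties as ℕₚ
open import Data.Product using (_×_; _,_; proj₁; proj₂; ∃; ∃-syntax; ∃!)
open import Data.Rational as ℚ using (ℚ; 0ℚ; 1ℚ; ½; ∣_∣; 1/_)
import Data.Rational.Properties as ℚₚ
open import Data.Rational.Solver using (module +-*-Solver)
open import Data.Sum using (_⊎_; inj₁; inj₂)
open import Data.Vec using (foldr₁; tabulate)
open import Data.Vec.Properties using (tabulate-cong)
open import Level using (0ℓ)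
open import Relation.Binary.PropositionalEquality
  using (_≡_; refl; sym; trans; cong; cong₂; subst; module ≡-Reasoning)
open import Relation.Nullary using (does; yes; no; contradiction)
open import Relation.Nullary.Decidable using (dec-true; dec-false)
open import Relation.Unary using (Pred; _∈_)

-- Cauchy sequences of rationals; equality of reals is _≃_, not _≡_.
record ℝ : Set where
  no-eta-equality
  field
    seq    : ℕ → ℚ
    cauchy : ∀ ε → 0ℚ ℚ.< ε →
             ∃[ N ] (∀ m n → N ≤ m → N ≤ n → ∣ seq m ℚ.- seq n ∣ ℚ.< ε)

open ℝ public

infix 4 _≤ᵣ_ _<ᵣ_ _≃_

_≤ᵣ_ : ℝ → ℝ → Set
x ≤ᵣ y = ∀ ε → 0ℚ ℚ.< ε → ∃[ N ] (∀ n → N ≤ n → seq x n ℚ.≤ seq y n ℚ.+ ε)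

_<ᵣ_ : ℝ → ℝ → Set
x <ᵣ y = ∃[ ε ] (0ℚ ℚ.< ε × ∃[ N ] (∀ n → N ≤ n → seq x n ℚ.+ ε ℚ.≤ seq y n))

_≃_ : ℝ → ℝ → Set
x ≃ y = x ≤ᵣ y × y ≤ᵣ x

fromℚ : ℚ → ℝ
seq    (fromℚ q) _     = q
cauchy (fromℚ q) ε 0<ε =
  0 , λ _ _ _ _ → subst (ℚ._< ε) (sym (cong ∣_∣ (ℚₚ.+-inverseʳ q))) 0<ε

0ᵣ : ℝ
0ᵣ = fromℚ 0ℚ

module _ where
  open +-*-Solver
  open ℚₚ.≤-Reasoning

  half-pos : ∀ {ε} → 0ℚ ℚ.< ε → 0ℚ ℚ.< ½ ℚ.* ε
  half-pos {ε} 0<ε = subst (ℚ._< ½ ℚ.* ε) (ℚₚ.*-zeroʳ ½) (ℚₚ.*-monoʳ-<-pos ½ 0<ε)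

  half+half : ∀ ε → ½ ℚ.* ε ℚ.+ ½ ℚ.* ε ≡ ε
  half+half = solve 1 (λ e → con ½ :* e :+ con ½ :* e := e) refl

  pos*pos : ∀ {p q} → 0ℚ ℚ.< p → 0ℚ ℚ.< q → 0ℚ ℚ.< p ℚ.* q
  pos*pos {p} {q} 0<p 0<q = subst (ℚ._< p ℚ.* q) (ℚₚ.*-zeroʳ p)
    (ℚₚ.*-monoʳ-<-pos p {{ℚ.positive 0<p}} 0<q)

  *-mono-≤ : ∀ {p q r s} → 0ℚ ℚ.≤ r → 0ℚ ℚ.≤ q → p ℚ.≤ q → r ℚ.≤ s → p ℚ.* r ℚ.≤ q ℚ.* s
  *-mono-≤ {p} {q} {r} {s} 0≤r 0≤q p≤q r≤s = ℚₚ.≤-trans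
    (ℚₚ.*-monoʳ-≤-nonNeg r {{ℚ.nonNegative 0≤r}} p≤q)
    (ℚₚ.*-monoˡ-≤-nonNeg q {{ℚ.nonNegative 0≤q}} r≤s)

  p≤q+∣p-q∣ : ∀ p q → p ℚ.≤ q ℚ.+ ∣ p ℚ.- q ∣
  p≤q+∣p-q∣ p q = begin
    p                      ≡⟨ solve 2 (λ a b → a := b :+ (a :- b)) refl p q ⟩
    q ℚ.+ (p ℚ.- q)        ≤⟨ ℚₚ.+-monoʳ-≤ q (p≤∣p∣ (p ℚ.- q)) ⟩
    q ℚ.+ ∣ p ℚ.- q ∣      ∎
    where
    p≤∣p∣ : ∀ p → p ℚ.≤ ∣ p ∣
    p≤∣p∣ p with ℚₚ.≤-total 0ℚ p
    ... | inj₁ 0≤p = ℚₚ.≤-reflexive (sym (ℚₚ.0≤p⇒∣p∣≡p 0≤p))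
    ... | inj₂ p≤0 = ℚₚ.≤-trans p≤0 (ℚₚ.0≤∣p∣ p)

  ∣p-q∣≡∣q-p∣ : ∀ p q → ∣ p ℚ.- q ∣ ≡ ∣ q ℚ.- p ∣
  ∣p-q∣≡∣q-p∣ p q = trans (sym (ℚₚ.∣-p∣≡∣p∣ (p ℚ.- q)))
    (cong ∣_∣ (solve 2 (λ a b → :- (a :- b) := b :- a) refl p q))

  ∣-∣< : ∀ {p q ε} → p ℚ.< q ℚ.+ ε → q ℚ.< p ℚ.+ ε → ∣ p ℚ.- q ∣ ℚ.< ε
  ∣-∣< {p} {q} {ε} p<q+ε q<p+ε with ℚₚ.∣p∣≡p∨∣p∣≡-p (p ℚ.- q)
  ... | inj₁ eq = begin-strict
    ∣ p ℚ.- q ∣          ≡⟨ eq ⟩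
    p ℚ.- q              <⟨ ℚₚ.+-monoˡ-< (ℚ.- q) p<q+ε ⟩
    q ℚ.+ ε ℚ.- q        ≡⟨ solve 2 (λ b e → b :+ e :- b := e) refl q ε ⟩
    ε                    ∎
  ... | inj₂ eq = begin-strict
    ∣ p ℚ.- q ∣          ≡⟨ eq ⟩
    ℚ.- (p ℚ.- q)        ≡⟨ solve 2 (λ a b → :- (a :- b) := b :- a) refl p q ⟩
    q ℚ.- p              <⟨ ℚₚ.+-monoˡ-< (ℚ.- p) q<p+ε ⟩
    p ℚ.+ ε ℚ.- p        ≡⟨ solve 2 (λ b e → b :+ e :- b := e) refl p ε ⟩
    ε                    ∎

  ∣-∣<⁻¹ : ∀ p q {ε} → ∣ p ℚ.- q ∣ ℚ.< ε → p ℚ.< q ℚ.+ ε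
  ∣-∣<⁻¹ p q h = ℚₚ.≤-<-trans (p≤q+∣p-q∣ p q) (ℚₚ.+-monoʳ-< q h)

  ⊔-step : ∀ p q r s {ε} → p ℚ.< r ℚ.+ ε → q ℚ.< s ℚ.+ ε → p ℚ.⊔ q ℚ.< r ℚ.⊔ s ℚ.+ ε
  ⊔-step p q r s {ε} p< q< with ℚₚ.⊔-sel p q
  ... | inj₁ eq rewrite eq = ℚₚ.<-≤-trans p< (ℚₚ.+-monoˡ-≤ ε (ℚₚ.p≤p⊔q r s))
  ... | inj₂ eq rewrite eq = ℚₚ.<-≤-trans q< (ℚₚ.+-monoˡ-≤ ε (ℚₚ.p≤q⊔p r s))

  ⊓-step : ∀ p q r s {ε} → p ℚ.< r ℚ.+ ε → q ℚ.< s ℚ.+ ε → p ℚ.⊓ q ℚ.< r ℚ.⊓ s ℚ.+ ε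
  ⊓-step p q r s {ε} p< q< with ℚₚ.⊓-sel r s
  ... | inj₁ eq rewrite eq = ℚₚ.≤-<-trans (ℚₚ.p⊓q≤p p q) p<
  ... | inj₂ eq rewrite eq = ℚₚ.≤-<-trans (ℚₚ.p⊓q≤q p q) q<

infixl 6 _+ᵣ_ _⊔ᵣ_
infixl 7 _*ᵣ_ _⊓ᵣ_

_+ᵣ_ : ℝ → ℝ → ℝ
seq    (x +ᵣ y) n     = seq x n ℚ.+ seq y n
cauchy (x +ᵣ y) ε 0<ε =
  let (M , xc) = cauchy x (½ ℚ.* ε) (half-pos 0<ε)
      (N , yc) = cauchy y (½ ℚ.* ε) (half-pos 0<ε)
  in M ⊔ N , λ m n m≥ n≥ → begin-strict
    ∣ (seq x m ℚ.+ seq y m) ℚ.- (seq x n ℚ.+ seq y n) ∣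
      ≡⟨ cong ∣_∣ (solve 4 (λ a b c d → (a :+ b) :- (c :+ d) := (a :- c) :+ (b :- d)) refl
           (seq x m) (seq y m) (seq x n) (seq y n)) ⟩
    ∣ (seq x m ℚ.- seq x n) ℚ.+ (seq y m ℚ.- seq y n) ∣
      ≤⟨ ℚₚ.∣p+q∣≤∣p∣+∣q∣ (seq x m ℚ.- seq x n) (seq y m ℚ.- seq y n) ⟩
    ∣ seq x m ℚ.- seq x n ∣ ℚ.+ ∣ seq y m ℚ.- seq y n ∣
      <⟨ ℚₚ.+-mono-< (xc m n (ℕₚ.m⊔n≤o⇒m≤o M N m≥) (ℕₚ.m⊔n≤o⇒m≤o M N n≥))
                     (yc m n (ℕₚ.m⊔n≤o⇒n≤o M N m≥) (ℕₚ.m⊔n≤o⇒n≤o M N n≥)) ⟩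
    ½ ℚ.* ε ℚ.+ ½ ℚ.* ε
      ≡⟨ half+half ε ⟩
    ε ∎
  where
  open +-*-Solver
  open ℚₚ.≤-Reasoning

_⊔ᵣ_ : ℝ → ℝ → ℝ
seq    (x ⊔ᵣ y) n     = seq x n ℚ.⊔ seq y n
cauchy (x ⊔ᵣ y) ε 0<ε =
  let (M , xc) = cauchy x ε 0<ε
      (N , yc) = cauchy y ε 0<ε
      step : ∀ m n → M ⊔ N ≤ m → M ⊔ N ≤ n →
             seq x m ℚ.⊔ seq y m ℚ.< seq x n ℚ.⊔ seq y n ℚ.+ ε
      step m n m≥ n≥ = ⊔-step (seq x m) (seq y m) (seq x n) (seq y n)
        (∣-∣<⁻¹ (seq x m) (seq x n) (xc m n (ℕₚ.m⊔n≤o⇒m≤o M N m≥) (ℕₚ.m⊔n≤o⇒m≤o M N n≥)))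
        (∣-∣<⁻¹ (seq y m) (seq y n) (yc m n (ℕₚ.m⊔n≤o⇒n≤o M N m≥) (ℕₚ.m⊔n≤o⇒n≤o M N n≥)))
  in M ⊔ N , λ m n m≥ n≥ → ∣-∣< (step m n m≥ n≥) (step n m n≥ m≥)

_⊓ᵣ_ : ℝ → ℝ → ℝ
seq    (x ⊓ᵣ y) n     = seq x n ℚ.⊓ seq y n
cauchy (x ⊓ᵣ y) ε 0<ε =
  let (M , xc) = cauchy x ε 0<ε
      (N , yc) = cauchy y ε 0<ε
      step : ∀ m n → M ⊔ N ≤ m → M ⊔ N ≤ n →
             seq x m ℚ.⊓ seq y m ℚ.< seq x n ℚ.⊓ seq y n ℚ.+ ε
      step m n m≥ n≥ = ⊓-step (seq x m) (seq y m) (seq x n) (seq y n)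
        (∣-∣<⁻¹ (seq x m) (seq x n) (xc m n (ℕₚ.m⊔n≤o⇒m≤o M N m≥) (ℕₚ.m⊔n≤o⇒m≤o M N n≥)))
        (∣-∣<⁻¹ (seq y m) (seq y n) (yc m n (ℕₚ.m⊔n≤o⇒n≤o M N m≥) (ℕₚ.m⊔n≤o⇒n≤o M N n≥)))
  in M ⊔ N , λ m n m≥ n≥ → ∣-∣< (step m n m≥ n≥) (step n m n≥ m≥)

bounded : ∀ x → ∃[ B ] (0ℚ ℚ.< B × ∃[ N ] (∀ n → N ≤ n → ∣ seq x n ∣ ℚ.≤ B))
bounded x = B , B>0 , N , bound
  where
  open +-*-Solver
  open ℚₚ.≤-Reasoning
  0<1 : 0ℚ ℚ.< 1ℚ
  0<1 = ℚₚ.positive⁻¹ 1ℚ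
  N = proj₁ (cauchy x 1ℚ 0<1)
  B = ∣ seq x N ∣ ℚ.+ 1ℚ
  B>0 : 0ℚ ℚ.< B
  B>0 = ℚₚ.+-mono-≤-< (ℚₚ.0≤∣p∣ (seq x N)) 0<1
  bound : ∀ n → N ≤ n → ∣ seq x n ∣ ℚ.≤ B
  bound n n≥ = begin
    ∣ seq x n ∣
      ≡⟨ cong ∣_∣ (solve 2 (λ a b → a := b :+ (a :- b)) refl (seq x n) (seq x N)) ⟩
    ∣ seq x N ℚ.+ (seq x n ℚ.- seq x N) ∣
      ≤⟨ ℚₚ.∣p+q∣≤∣p∣+∣q∣ (seq x N) (seq x n ℚ.- seq x N) ⟩
    ∣ seq x N ∣ ℚ.+ ∣ seq x n ℚ.- seq x N ∣
      ≤⟨ ℚₚ.+-monoʳ-≤ ∣ seq x N ∣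
           (ℚₚ.<⇒≤ (proj₂ (cauchy x 1ℚ 0<1) n N n≥ ℕₚ.≤-refl)) ⟩
    B ∎

module _ where
  open +-*-Solver
  open ℚₚ.≤-Reasoning

  cancel : ∀ D .{{_ : ℚ.NonZero D}} e → D ℚ.* (e ℚ.* 1/ D) ≡ e
  cancel D e = begin-equality
    D ℚ.* (e ℚ.* 1/ D)
      ≡⟨ solve 3 (λ d e i → d :* (e :* i) := e :* (d :* i)) refl D e (1/ D) ⟩
    e ℚ.* (D ℚ.* 1/ D)   ≡⟨ cong (e ℚ.*_) (ℚₚ.*-inverseʳ D) ⟩
    e ℚ.* 1ℚ             ≡⟨ ℚₚ.*-identityʳ e ⟩
    e                    ∎

  *-estimate : ∀ {B C δ η} a b a′ b′ → 0ℚ ℚ.< B → 0ℚ ℚ.< C →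
    ∣ a ∣ ℚ.≤ B → ∣ b′ ∣ ℚ.≤ C → ∣ a ℚ.- a′ ∣ ℚ.< η → ∣ b ℚ.- b′ ∣ ℚ.< δ →
    ∣ a ℚ.* b ℚ.- a′ ℚ.* b′ ∣ ℚ.< B ℚ.* δ ℚ.+ C ℚ.* η
  *-estimate {B} {C} {δ} {η} a b a′ b′ 0<B 0<C ∣a∣≤B ∣b′∣≤C da db = begin-strict
    ∣ a ℚ.* b ℚ.- a′ ℚ.* b′ ∣
      ≡⟨ cong ∣_∣ (solve 4 (λ a b c d → a :* b :- c :* d := a :* (b :- d) :+ d :* (a :- c))
           refl a b a′ b′) ⟩
    ∣ a ℚ.* (b ℚ.- b′) ℚ.+ b′ ℚ.* (a ℚ.- a′) ∣
      ≤⟨ ℚₚ.∣p+q∣≤∣p∣+∣q∣ (a ℚ.* (b ℚ.- b′)) (b′ ℚ.* (a ℚ.- a′)) ⟩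
    ∣ a ℚ.* (b ℚ.- b′) ∣ ℚ.+ ∣ b′ ℚ.* (a ℚ.- a′) ∣
      ≡⟨ cong₂ ℚ._+_ (ℚₚ.∣p*q∣≡∣p∣*∣q∣ a (b ℚ.- b′)) (ℚₚ.∣p*q∣≡∣p∣*∣q∣ b′ (a ℚ.- a′)) ⟩
    ∣ a ∣ ℚ.* ∣ b ℚ.- b′ ∣ ℚ.+ ∣ b′ ∣ ℚ.* ∣ a ℚ.- a′ ∣
      ≤⟨ ℚₚ.+-mono-≤
           (ℚₚ.*-monoʳ-≤-nonNeg ∣ b ℚ.- b′ ∣ {{ℚₚ.∣-∣-nonNeg (b ℚ.- b′)}} ∣a∣≤B)
           (ℚₚ.*-monoʳ-≤-nonNeg ∣ a ℚ.- a′ ∣ {{ℚₚ.∣-∣-nonNeg (a ℚ.- a′)}} ∣b′∣≤C) ⟩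
    B ℚ.* ∣ b ℚ.- b′ ∣ ℚ.+ C ℚ.* ∣ a ℚ.- a′ ∣
      <⟨ ℚₚ.+-mono-< (ℚₚ.*-monoʳ-<-pos B {{ℚ.positive 0<B}} db)
                     (ℚₚ.*-monoʳ-<-pos C {{ℚ.positive 0<C}} da) ⟩
    B ℚ.* δ ℚ.+ C ℚ.* η ∎

  scale : ∀ {B ε} → 0ℚ ℚ.< B → 0ℚ ℚ.< ε → ∃[ δ ] (0ℚ ℚ.< δ × B ℚ.* δ ≡ ½ ℚ.* ε)
  scale {B} {ε} 0<B 0<ε =
    (½ ℚ.* ε) ℚ.* 1/B , pos*pos (half-pos 0<ε) 0<1/B , cancel B {{B≢0}} (½ ℚ.* ε)
    where
    B≢0 = ℚₚ.pos⇒nonZero B {{ℚ.positive 0<B}}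
    1/B = (1/ B) {{B≢0}}
    0<1/B : 0ℚ ℚ.< 1/B
    0<1/B = ℚₚ.positive⁻¹ 1/B {{ℚₚ.1/pos⇒pos B {{ℚ.positive 0<B}}}}

_*ᵣ_ : ℝ → ℝ → ℝ
seq    (x *ᵣ y) n     = seq x n ℚ.* seq y n
cauchy (x *ᵣ y) ε 0<ε =
    let (B , 0<B , K , xb) = bounded x
        (C , 0<C , L , yb) = bounded y
        (δ , 0<δ , Bδ) = scale {B} {ε} 0<B 0<ε
        (η , 0<η , Cη) = scale {C} {ε} 0<C 0<ε
        (M , xc) = cauchy x η 0<η
        (N , yc) = cauchy y δ 0<δ
    in (K ⊔ L) ⊔ (M ⊔ N) , λ m n m≥ n≥ →
      let m≥KL = ℕₚ.m⊔n≤o⇒m≤o (K ⊔ L) (M ⊔ N) m≥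
          n≥KL = ℕₚ.m⊔n≤o⇒m≤o (K ⊔ L) (M ⊔ N) n≥
          m≥MN = ℕₚ.m⊔n≤o⇒n≤o (K ⊔ L) (M ⊔ N) m≥
          n≥MN = ℕₚ.m⊔n≤o⇒n≤o (K ⊔ L) (M ⊔ N) n≥
      in subst (∣ seq x m ℚ.* seq y m ℚ.- seq x n ℚ.* seq y n ∣ ℚ.<_)
           (trans (cong₂ ℚ._+_ Bδ Cη) (half+half ε))
           (*-estimate (seq x m) (seq y m) (seq x n) (seq y n) 0<B 0<C
             (xb m (ℕₚ.m⊔n≤o⇒m≤o K L m≥KL))
             (yb n (ℕₚ.m⊔n≤o⇒n≤o K L n≥KL))
             (xc m n (ℕₚ.m⊔n≤o⇒m≤o M N m≥MN) (ℕₚ.m⊔n≤o⇒m≤o M N n≥MN))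
             (yc m n (ℕₚ.m⊔n≤o⇒n≤o M N m≥MN) (ℕₚ.m⊔n≤o⇒n≤o M N n≥MN)))

-- From some index on, seq y n ≥ δ, where δ is the bound contained in the proof
-- of 0ᵣ <ᵣ y; taking the maximum with δ only changes earlier terms.
module Inverse (y : ℝ) (0<y : 0ᵣ <ᵣ y) where
  open +-*-Solver
  open ℚₚ.≤-Reasoning

  δ : ℚ
  δ = proj₁ 0<y

  0<δ : 0ℚ ℚ.< δ
  0<δ = proj₁ (proj₂ 0<y)

  den : ℕ → ℚ
  den n = seq y n ℚ.⊔ δ

  δ≤den : ∀ n → δ ℚ.≤ den n
  δ≤den n = ℚₚ.p≤q⊔p (seq y n) δ

  den-pos : ∀ n → ℚ.Positive (den n)
  den-pos n = ℚ.positive (ℚₚ.<-≤-trans 0<δ (δ≤den n))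

  den≢0 : ∀ n → ℚ.NonZero (den n)
  den≢0 n = ℚₚ.pos⇒nonZero (den n) {{den-pos n}}

  inv : ℕ → ℚ
  inv n = (1/ den n) {{den≢0 n}}

  inv-pos : ∀ n → ℚ.Positive (inv n)
  inv-pos n = ℚₚ.1/pos⇒pos (den n) {{den-pos n}}

  den*inv : ∀ n → den n ℚ.* inv n ≡ 1ℚ
  den*inv n = ℚₚ.*-inverseʳ (den n) {{den≢0 n}}

  inv-cauchy : ∀ ε → 0ℚ ℚ.< ε →
               ∃[ N ] (∀ m n → N ≤ m → N ≤ n → ∣ inv m ℚ.- inv n ∣ ℚ.< ε)
  inv-cauchy ε 0<ε = proj₁ dc , λ m n m≥ n≥ →
    ∣-∣< (step m n (proj₂ dc n m n≥ m≥)) (step n m (proj₂ dc m n m≥ n≥))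
    where
    dc = cauchy (y ⊔ᵣ fromℚ δ) (ε ℚ.* (δ ℚ.* δ)) (pos*pos 0<ε (pos*pos 0<δ 0<δ))
    step : ∀ m n → ∣ den n ℚ.- den m ∣ ℚ.< ε ℚ.* (δ ℚ.* δ) → inv m ℚ.< inv n ℚ.+ ε
    step m n h = ℚₚ.*-cancelˡ-<-nonNeg a {{ℚₚ.pos⇒nonNeg a {{den-pos m}}}}
      (ℚₚ.*-cancelˡ-<-nonNeg b {{ℚₚ.pos⇒nonNeg b {{den-pos n}}}} (begin-strict
        b ℚ.* (a ℚ.* inv m)   ≡⟨ cong (b ℚ.*_) (den*inv m) ⟩
        b ℚ.* 1ℚ              ≡⟨ ℚₚ.*-identityʳ b ⟩
        b                     <⟨ ∣-∣<⁻¹ b a h ⟩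
        a ℚ.+ ε ℚ.* (δ ℚ.* δ)
          ≤⟨ ℚₚ.+-monoʳ-≤ a (ℚₚ.*-monoˡ-≤-nonNeg ε {{ℚ.nonNegative (ℚₚ.<⇒≤ 0<ε)}}
               (*-mono-≤ 0≤δ 0≤b (δ≤den n) (δ≤den m))) ⟩
        a ℚ.+ ε ℚ.* (b ℚ.* a)
          ≡⟨ cong (ℚ._+ ε ℚ.* (b ℚ.* a)) (sym (ℚₚ.*-identityʳ a)) ⟩
        a ℚ.* 1ℚ ℚ.+ ε ℚ.* (b ℚ.* a)
          ≡⟨ cong (λ u → a ℚ.* u ℚ.+ ε ℚ.* (b ℚ.* a)) (sym (den*inv n)) ⟩
        a ℚ.* (b ℚ.* inv n) ℚ.+ ε ℚ.* (b ℚ.* a)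
          ≡⟨ solve 4 (λ a b i e → a :* (b :* i) :+ e :* (b :* a) := b :* (a :* (i :+ e)))
               refl a b (inv n) ε ⟩
        b ℚ.* (a ℚ.* (inv n ℚ.+ ε)) ∎))
      where
      a = den m
      b = den n
      0≤δ = ℚₚ.<⇒≤ 0<δ
      0≤b = ℚₚ.≤-trans 0≤δ (δ≤den n)

  inverse : ℝ
  seq    inverse = inv
  cauchy inverse = inv-cauchy

divide : (x y : ℝ) → 0ᵣ <ᵣ y → ℝ
divide x y 0<y = x *ᵣ Inverse.inverse y 0<y

-- Jobs are the positive natural numbers; size 0 is meaningless, unconstrained and never used.
record Realization : Set where
  field
    size       : ℕ → ℝ
    decreasing : ∀ {i j} → 1 ≤ i → i ≤ j → size j ≤ᵣ size i
    nonneg     : ∀ {j} → 1 ≤ j → 0ᵣ ≤ᵣ size j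
    support    : ℕ
    vanishing  : ∀ {j} → support <ℕ j → size j ≃ 0ᵣ

record Solution (m : ℕ) : Set₁ where
  field
    J         : Fin m → Pred ℕ 0ℓ
    partition : ∀ j .{{_ : NonZero j}} → ∃! _≡_ (λ i → j ∈ J i)

  machine : ∀ j .{{_ : NonZero j}} → Fin m
  machine j = proj₁ (partition j)

open Realization public
open Solution public

private variable m k : ℕ

-- Total size of those jobs among 1, …, n that belong to J s i.
partialLoad : Realization → Solution m → Fin m → ℕ → ℝ
partialLoad p s i zero    = 0ᵣ
partialLoad p s i (suc n) = partialLoad p s i n +ᵣ
  (if does (machine s (suc n) Fin.≟ i) then size p (suc n) else 0ᵣ)

load : Realization → Solution m → Fin m → ℝ
load p s i = partialLoad p s i (support p)

completionTime : Realization → Solution (suc k) → ℝ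
completionTime p s = foldr₁ _⊔ᵣ_ (tabulate (load p s))

TwoSolutionAlgorithm : ℕ → Set₁
TwoSolutionAlgorithm m = Solution m × Solution m

makespan : Realization → TwoSolutionAlgorithm (suc k) → ℝ
makespan p (s₁ , s₂) = completionTime p s₁ ⊓ᵣ completionTime p s₂

-- Optimal time on suc k machines: the minimum over all solutions is expressed as their greatest lower bound.
-- Only finitely many completion times occur, so classically it is attained;
-- constructively one cannot in general exhibit a solution attaining it.
IsOptimalTime : (k : ℕ) → Realization → ℝ → Set₁
IsOptimalTime k p opt =
  (∀ (s : Solution (suc k)) → opt ≤ᵣ completionTime p s) ×
  (∀ x → (∀ (s : Solution (suc k)) → x ≤ᵣ completionTime p s) → x ≤ᵣ opt)

-- IsOptimalTime is never an empty condition: every realization has an optimal time.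
module OptimalTimeExists (k : ℕ) (p : Realization) where

  ≤ᵣ-refl : ∀ {x} → x ≤ᵣ x
  ≤ᵣ-refl {x} ε 0<ε = 0 , λ n _ →
    subst (ℚ._≤ seq x n ℚ.+ ε) (ℚₚ.+-identityʳ (seq x n)) (ℚₚ.+-monoʳ-≤ (seq x n) (ℚₚ.<⇒≤ 0<ε))

  ≤ᵣ-trans : ∀ {x y z} → x ≤ᵣ y → y ≤ᵣ z → x ≤ᵣ z
  ≤ᵣ-trans {x} {y} {z} x≤y y≤z ε 0<ε =
    let (M , f) = x≤y (½ ℚ.* ε) (half-pos 0<ε)
        (N , g) = y≤z (½ ℚ.* ε) (half-pos 0<ε)
    in M ⊔ N , λ n n≥ → begin
      seq x n                              ≤⟨ f n (ℕₚ.m⊔n≤o⇒m≤o M N n≥) ⟩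
      seq y n ℚ.+ h ε                      ≤⟨ ℚₚ.+-monoˡ-≤ (h ε) (g n (ℕₚ.m⊔n≤o⇒n≤o M N n≥)) ⟩
      seq z n ℚ.+ h ε ℚ.+ h ε              ≡⟨ ℚₚ.+-assoc (seq z n) (h ε) (h ε) ⟩
      seq z n ℚ.+ (h ε ℚ.+ h ε)            ≡⟨ cong (seq z n ℚ.+_) (half+half ε) ⟩
      seq z n ℚ.+ ε                        ∎
    where
    open ℚₚ.≤-Reasoning
    h = λ ε → ½ ℚ.* ε

  ⊓ᵣ-lowerˡ : ∀ {x y} → x ⊓ᵣ y ≤ᵣ x
  ⊓ᵣ-lowerˡ {x} {y} ε 0<ε = let (N , f) = ≤ᵣ-refl {x} ε 0<ε in
    N , λ n n≥ → ℚₚ.≤-trans (ℚₚ.p⊓q≤p (seq x n) (seq y n)) (f n n≥)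

  ⊓ᵣ-lowerʳ : ∀ {x y} → x ⊓ᵣ y ≤ᵣ y
  ⊓ᵣ-lowerʳ {x} {y} ε 0<ε = let (N , f) = ≤ᵣ-refl {y} ε 0<ε in
    N , λ n n≥ → ℚₚ.≤-trans (ℚₚ.p⊓q≤q (seq x n) (seq y n)) (f n n≥)

  ⊓ᵣ-greatest : ∀ {x y z} → x ≤ᵣ y → x ≤ᵣ z → x ≤ᵣ y ⊓ᵣ z
  ⊓ᵣ-greatest {x} {y} {z} x≤y x≤z ε 0<ε =
    let (M , f) = x≤y ε 0<ε
        (N , g) = x≤z ε 0<ε
    in M ⊔ N , λ n n≥ → step n (f n (ℕₚ.m⊔n≤o⇒m≤o M N n≥)) (g n (ℕₚ.m⊔n≤o⇒n≤o M N n≥))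
    where
    step : ∀ n → seq x n ℚ.≤ seq y n ℚ.+ ε → seq x n ℚ.≤ seq z n ℚ.+ ε →
           seq x n ℚ.≤ seq y n ℚ.⊓ seq z n ℚ.+ ε
    step n a b with ℚₚ.⊓-sel (seq y n) (seq z n)
    ... | inj₁ eq rewrite eq = a
    ... | inj₂ eq rewrite eq = b

  minimum : ∀ {n} → (Fin (suc n) → ℝ) → ℝ
  minimum f = foldr₁ _⊓ᵣ_ (tabulate f)

  minimum-lower : ∀ {n} (f : Fin (suc n) → ℝ) i → minimum f ≤ᵣ f i
  minimum-lower {zero}  f 0F = ≤ᵣ-refl {f 0F}
  minimum-lower {suc n} f 0F = ⊓ᵣ-lowerˡ {f 0F} {minimum (λ i → f (Fin.suc i))}
  minimum-lower {suc n} f (Fin.suc i) =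
    ≤ᵣ-trans {minimum f} {minimum (λ i → f (Fin.suc i))} {f (Fin.suc i)}
      (⊓ᵣ-lowerʳ {f 0F} {minimum (λ i → f (Fin.suc i))})
      (minimum-lower (λ i → f (Fin.suc i)) i)

  minimum-greatest : ∀ {n} (f : Fin (suc n) → ℝ) x → (∀ i → x ≤ᵣ f i) → x ≤ᵣ minimum f
  minimum-greatest {zero}  f x h = h 0F
  minimum-greatest {suc n} f x h = ⊓ᵣ-greatest {x} {f 0F} {minimum (λ i → f (Fin.suc i))}
    (h 0F) (minimum-greatest (λ i → f (Fin.suc i)) x (λ i → h (Fin.suc i)))

  fromAssignment : (ℕ → Fin m) → Solution m
  fromAssignment a = record
    { J         = λ i j → a j ≡ i
    ; partition = λ j → a j , refl , λ eq → eq
    }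

  update : (ℕ → Fin m) → ℕ → Fin m → ℕ → Fin m
  update a n i j = if does (j ℕₚ.≟ n) then i else a j

  -- Minimum over the assignments that agree with a on all jobs after n.
  best : ℕ → (ℕ → Fin (suc k)) → ℝ
  best zero    a = completionTime p (fromAssignment a)
  best (suc n) a = minimum (λ i → best n (update a (suc n) i))

  Agree : Solution (suc k) → (ℕ → Fin (suc k)) → ℕ → Set
  Agree s a n = ∀ j → n ≤ j → suc j ≤ support p → machine s (suc j) ≡ a (suc j)

  partialLoad-cong : ∀ s a i n → n ≤ support p → Agree s a 0 →
                     partialLoad p (fromAssignment a) i n ≡ partialLoad p s i n
  partialLoad-cong s a i zero    _  _ = refl
  partialLoad-cong s a i (suc n) n≤ h = cong₂
    (λ x j → x +ᵣ (if does (j Fin.≟ i) then size p (suc n) else 0ᵣ))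
    (partialLoad-cong s a i n (ℕₚ.<⇒≤ n≤) h) (sym (h n z≤n n≤))

  best-lower : ∀ n a s → Agree s a n → best n a ≤ᵣ completionTime p s
  best-lower zero a s h = subst (λ t → completionTime p (fromAssignment a) ≤ᵣ t)
    (cong (foldr₁ _⊔ᵣ_)
      (tabulate-cong λ i → partialLoad-cong s a i (support p) ℕₚ.≤-refl h))
    (≤ᵣ-refl {completionTime p (fromAssignment a)})
  best-lower (suc n) a s h =
    ≤ᵣ-trans {best (suc n) a} {best n (update a (suc n) i₀)} {completionTime p s}
      (minimum-lower (λ i → best n (update a (suc n) i)) i₀)
      (best-lower n (update a (suc n) i₀) s agree)
    where
    i₀ = machine s (suc n)
    agree : Agree s (update a (suc n) i₀) n
    agree j n≤j j< with j ℕₚ.≟ n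
    ... | yes refl rewrite dec-true (suc j ℕₚ.≟ suc j) refl = refl
    ... | no  j≢n  rewrite dec-false (suc j ℕₚ.≟ suc n) (λ eq → j≢n (ℕₚ.suc-injective eq)) =
      h j (ℕₚ.≤∧≢⇒< n≤j (λ n≡j → j≢n (sym n≡j))) j<

  best-greatest : ∀ n a x → (∀ (s : Solution (suc k)) → x ≤ᵣ completionTime p s) → x ≤ᵣ best n a
  best-greatest zero    a x h = h (fromAssignment a)
  best-greatest (suc n) a x h = minimum-greatest (λ i → best n (update a (suc n) i)) x
    (λ i → best-greatest n (update a (suc n) i) x h)

  optimalTime-exists : ∃ (IsOptimalTime k p)
  optimalTime-exists = best (support p) (λ _ → 0F)
    , (λ s → best-lower (support p) (λ _ → 0F) s
        (λ j N≤j j<N → contradiction (ℕₚ.≤-trans j<N N≤j) (ℕₚ.<-irrefl refl)))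
    , best-greatest (support p) (λ _ → 0F)

-- The supremum of the ratios is at most c exactly when c is an upper bound of them.
CompetitiveRatio≤ : TwoSolutionAlgorithm (suc k) → ℝ → Set₁
CompetitiveRatio≤ {k} A c =
  ∀ p opt → IsOptimalTime k p opt → (0<opt : 0ᵣ <ᵣ opt) →
  divide (makespan p A) opt 0<opt ≤ᵣ c

-- 0F, …, 4F stand for machines 1, …, 5.
J₁ : Fin 5 → Pred ℕ 0ℓ
J₁ 0F j = ∃[ k ] j ≡ 10 *ℕ k +ℕ 1
J₁ 1F j = ∃[ k ] j ≡ 10 *ℕ k +ℕ 2
J₁ 2F j = ∃[ k ] j ≡ 5 *ℕ k +ℕ 3
J₁ 3F j = (∃[ k ] j ≡ 10 *ℕ k +ℕ 4) ⊎ (∃[ k ] j ≡ 10 *ℕ k +ℕ 7) ⊎ (∃[ k ] (1 ≤ k × j ≡ 10 *ℕ k))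
J₁ 4F j = (∃[ k ] j ≡ 10 *ℕ k +ℕ 5) ⊎ (∃[ k ] j ≡ 10 *ℕ k +ℕ 6) ⊎ (∃[ k ] j ≡ 10 *ℕ k +ℕ 9)

J₂ : Fin 5 → Pred ℕ 0ℓ
J₂ 0F j = j ≡ 1 ⊎ (∃[ k ] (2 ≤ k × j ≡ 5 *ℕ k))
J₂ 1F j = j ≡ 2 ⊎ (∃[ k ] (2 ≤ k × j ≡ 5 *ℕ k ∸ℕ 1))
J₂ 2F j = ∃[ k ] (1 ≤ k × j ≡ 5 *ℕ k ∸ℕ 2)
J₂ 3F j = j ≡ 4 ⊎ (∃[ k ] (2 ≤ k × j ≡ 5 *ℕ k ∸ℕ 3))
J₂ 4F j = j ≡ 5 ⊎ (∃[ k ] (2 ≤ k × j ≡ 5 *ℕ k ∸ℕ 4))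

machine₁ : ℕ → Fin 5
machine₁ 0 = 3F
machine₁ 1 = 0F
machine₁ 2 = 1F
machine₁ 3 = 2F
machine₁ 4 = 3F
machine₁ 5 = 4F
machine₁ 6 = 4F
machine₁ 7 = 3F
machine₁ 8 = 2F
machine₁ 9 = 4F
machine₁ (suc (suc (suc (suc (suc (suc (suc (suc (suc (suc j)))))))))) = machine₁ j

private
  step₁ : ∀ i {j} → J₁ i j → J₁ i (10 +ℕ j)
  step₁ 0F (k , refl) = suc k , cong (_+ℕ 1) (sym (ℕₚ.*-suc 10 k))
  step₁ 1F (k , refl) = suc k , cong (_+ℕ 2) (sym (ℕₚ.*-suc 10 k))
  step₁ 2F (k , refl) = 2 +ℕ k , cong (_+ℕ 3) (sym (ℕₚ.*-distribˡ-+ 5 2 k))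
  step₁ 3F (inj₁ (k , refl)) = inj₁ (suc k , cong (_+ℕ 4) (sym (ℕₚ.*-suc 10 k)))
  step₁ 3F (inj₂ (inj₁ (k , refl))) = inj₂ (inj₁ (suc k , cong (_+ℕ 7) (sym (ℕₚ.*-suc 10 k))))
  step₁ 3F (inj₂ (inj₂ (k , _ , refl))) = inj₂ (inj₂ (suc k , s≤s z≤n , sym (ℕₚ.*-suc 10 k)))
  step₁ 4F (inj₁ (k , refl)) = inj₁ (suc k , cong (_+ℕ 5) (sym (ℕₚ.*-suc 10 k)))
  step₁ 4F (inj₂ (inj₁ (k , refl))) = inj₂ (inj₁ (suc k , cong (_+ℕ 6) (sym (ℕₚ.*-suc 10 k))))
  step₁ 4F (inj₂ (inj₂ (k , refl))) = inj₂ (inj₂ (suc k , cong (_+ℕ 9) (sym (ℕₚ.*-suc 10 k))))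

  covers₁ : ∀ j .{{_ : NonZero j}} → J₁ (machine₁ j) j
  covers₁ 1 = 0 , refl
  covers₁ 2 = 0 , refl
  covers₁ 3 = 0 , refl
  covers₁ 4 = inj₁ (0 , refl)
  covers₁ 5 = inj₁ (0 , refl)
  covers₁ 6 = inj₂ (inj₁ (0 , refl))
  covers₁ 7 = inj₂ (inj₁ (0 , refl))
  covers₁ 8 = 1 , refl
  covers₁ 9 = inj₂ (inj₂ (0 , refl))
  covers₁ 10 = inj₂ (inj₂ (1 , s≤s z≤n , refl))
  covers₁ (suc (suc (suc (suc (suc (suc (suc (suc (suc (suc j@(suc _))))))))))) =
    step₁ (machine₁ j) (covers₁ j)

  period₁ : ∀ k r → machine₁ (10 *ℕ k +ℕ r) ≡ machine₁ r
  period₁ zero    r = refl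
  period₁ (suc k) r =
    trans (cong (λ t → machine₁ (t +ℕ r)) (ℕₚ.*-suc 10 k)) (period₁ k r)

  period₁′ : ∀ k → machine₁ (5 *ℕ k +ℕ 3) ≡ 2F
  period₁′ 0 = refl
  period₁′ 1 = refl
  period₁′ (suc (suc k)) =
    trans (cong (λ t → machine₁ (t +ℕ 3)) (ℕₚ.*-distribˡ-+ 5 2 k)) (period₁′ k)

  unique₁ : ∀ i j → J₁ i j → machine₁ j ≡ i
  unique₁ 0F _ (k , refl) = period₁ k 1
  unique₁ 1F _ (k , refl) = period₁ k 2
  unique₁ 2F _ (k , refl) = period₁′ k
  unique₁ 3F _ (inj₁ (k , refl)) = period₁ k 4
  unique₁ 3F _ (inj₂ (inj₁ (k , refl))) = period₁ k 7
  unique₁ 3F _ (inj₂ (inj₂ (k , _ , refl))) =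
    trans (cong machine₁ (sym (ℕₚ.+-identityʳ (10 *ℕ k)))) (period₁ k 0)
  unique₁ 4F _ (inj₁ (k , refl)) = period₁ k 5
  unique₁ 4F _ (inj₂ (inj₁ (k , refl))) = period₁ k 6
  unique₁ 4F _ (inj₂ (inj₂ (k , refl))) = period₁ k 9

solution₁ : Solution 5
solution₁ = record
  { J         = J₁
  ; partition = λ j → machine₁ j , covers₁ j , λ {i} → unique₁ i j
  }

-- tail₂ n is the machine of job 6 + n.
tail₂ : ℕ → Fin 5
tail₂ 0 = 4F
tail₂ 1 = 3F
tail₂ 2 = 2F
tail₂ 3 = 1F
tail₂ 4 = 0F
tail₂ (suc (suc (suc (suc (suc n))))) = tail₂ n

-- The value at 0 is arbitrary.
machine₂ : ℕ → Fin 5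
machine₂ 0 = 0F
machine₂ 1 = 0F
machine₂ 2 = 1F
machine₂ 3 = 2F
machine₂ 4 = 3F
machine₂ 5 = 4F
machine₂ (suc (suc (suc (suc (suc (suc n)))))) = tail₂ n

private
  shift : ∀ k d → d ≤ 5 → 1 ≤ k → 5 +ℕ (5 *ℕ k ∸ℕ d) ≡ 5 *ℕ suc k ∸ℕ d
  shift k d d≤5 1≤k = trans
    (sym (ℕₚ.+-∸-assoc 5 (ℕₚ.≤-trans d≤5 (ℕₚ.*-monoʳ-≤ 5 1≤k))))
    (cong (_∸ℕ d) (sym (ℕₚ.*-suc 5 k)))

  pred≤ : ∀ {k} → 2 ≤ k → 1 ≤ k
  pred≤ = ℕₚ.≤-trans (s≤s z≤n)

  step₂ : ∀ i {n} → J₂ i (6 +ℕ n) → J₂ i (11 +ℕ n)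
  step₂ 0F (inj₂ (k , 2≤k , eq)) = inj₂ (suc k , ℕₚ.m≤n⇒m≤1+n 2≤k ,
    trans (cong (5 +ℕ_) eq) (shift k 0 z≤n (pred≤ 2≤k)))
  step₂ 1F (inj₂ (k , 2≤k , eq)) = inj₂ (suc k , ℕₚ.m≤n⇒m≤1+n 2≤k ,
    trans (cong (5 +ℕ_) eq) (shift k 1 (ℕₚ.m≤m+n 1 4) (pred≤ 2≤k)))
  step₂ 2F (k , 1≤k , eq) = suc k , s≤s z≤n ,
    trans (cong (5 +ℕ_) eq) (shift k 2 (ℕₚ.m≤m+n 2 3) 1≤k)
  step₂ 3F (inj₂ (k , 2≤k , eq)) = inj₂ (suc k , ℕₚ.m≤n⇒m≤1+n 2≤k ,
    trans (cong (5 +ℕ_) eq) (shift k 3 (ℕₚ.m≤m+n 3 2) (pred≤ 2≤k)))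
  step₂ 4F (inj₂ (k , 2≤k , eq)) = inj₂ (suc k , ℕₚ.m≤n⇒m≤1+n 2≤k ,
    trans (cong (5 +ℕ_) eq) (shift k 4 (ℕₚ.m≤m+n 4 1) (pred≤ 2≤k)))

  coversTail₂ : ∀ n → J₂ (tail₂ n) (6 +ℕ n)
  coversTail₂ 0 = inj₂ (2 , ℕₚ.≤-refl , refl)
  coversTail₂ 1 = inj₂ (2 , ℕₚ.≤-refl , refl)
  coversTail₂ 2 = 2 , s≤s z≤n , refl
  coversTail₂ 3 = inj₂ (2 , ℕₚ.≤-refl , refl)
  coversTail₂ 4 = inj₂ (2 , ℕₚ.≤-refl , refl)
  coversTail₂ (suc (suc (suc (suc (suc n))))) = step₂ (tail₂ n) (coversTail₂ n)

  covers₂ : ∀ j .{{_ : NonZero j}} → J₂ (machine₂ j) j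
  covers₂ 1 = inj₁ refl
  covers₂ 2 = inj₁ refl
  covers₂ 3 = 1 , s≤s z≤n , refl
  covers₂ 4 = inj₁ refl
  covers₂ 5 = inj₁ refl
  covers₂ (suc (suc (suc (suc (suc (suc n)))))) = coversTail₂ n

  period₂ : ∀ r k → tail₂ (r +ℕ 5 *ℕ k) ≡ tail₂ r
  period₂ r zero    = cong tail₂ (ℕₚ.+-identityʳ r)
  period₂ r (suc k) = trans (cong tail₂ eq) (period₂ r k)
    where
    eq : r +ℕ 5 *ℕ suc k ≡ 5 +ℕ (r +ℕ 5 *ℕ k)
    eq = begin
      r +ℕ 5 *ℕ suc k        ≡⟨ cong (r +ℕ_) (ℕₚ.*-suc 5 k) ⟩
      r +ℕ (5 +ℕ 5 *ℕ k)     ≡⟨ sym (ℕₚ.+-assoc r 5 (5 *ℕ k)) ⟩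
      (r +ℕ 5) +ℕ 5 *ℕ k     ≡⟨ cong (_+ℕ 5 *ℕ k) (ℕₚ.+-comm r 5) ⟩
      5 +ℕ (r +ℕ 5 *ℕ k)     ∎
      where open ≡-Reasoning

  unique₂ : ∀ i j → J₂ i j → machine₂ j ≡ i
  unique₂ 0F _ (inj₁ refl) = refl
  unique₂ 1F _ (inj₁ refl) = refl
  unique₂ 3F _ (inj₁ refl) = refl
  unique₂ 4F _ (inj₁ refl) = refl
  unique₂ 0F _ (inj₂ (suc (suc k) , s≤s (s≤s z≤n) , refl)) =
    trans (cong (λ t → machine₂ (t ∸ℕ 0)) (ℕₚ.*-distribˡ-+ 5 2 k)) (period₂ 4 k)
  unique₂ 1F _ (inj₂ (suc (suc k) , s≤s (s≤s z≤n) , refl)) =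
    trans (cong (λ t → machine₂ (t ∸ℕ 1)) (ℕₚ.*-distribˡ-+ 5 2 k)) (period₂ 3 k)
  unique₂ 2F _ (suc zero , _ , refl) = refl
  unique₂ 2F _ (suc (suc k) , _ , refl) =
    trans (cong (λ t → machine₂ (t ∸ℕ 2)) (ℕₚ.*-distribˡ-+ 5 2 k)) (period₂ 2 k)
  unique₂ 3F _ (inj₂ (suc (suc k) , s≤s (s≤s z≤n) , refl)) =
    trans (cong (λ t → machine₂ (t ∸ℕ 3)) (ℕₚ.*-distribˡ-+ 5 2 k)) (period₂ 1 k)
  unique₂ 4F _ (inj₂ (suc (suc k) , s≤s (s≤s z≤n) , refl)) =
    trans (cong (λ t → machine₂ (t ∸ℕ 4)) (ℕₚ.*-distribˡ-+ 5 2 k)) (period₂ 0 k)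

solution₂ : Solution 5
solution₂ = record
  { J         = J₂
  ; partition = λ j → machine₂ j , covers₂ j , λ {i} → unique₂ i j
  }

fiveMachineAlgorithm : TwoSolutionAlgorithm 5
fiveMachineAlgorithm = solution₁ , solution₂

{-# OPTIONS --safe #-}
-- Let λ be the optimal time, L_i and R_k the loads of the two solutions. The
-- makespan is L_i ⊓ R_k for some i and k, so it suffices that for every pair
-- (i, k) a combination a L_i + b R_k is at most 7/5 (a + b) λ. Only p₁ ≤ λ,
-- p₅ + p₆ ≤ λ (two of the first six jobs share a machine) and
-- p₁ + p₂ + … ≤ 5 λ are needed: since the sizes decrease, a linear form in them
-- is nonnegative as soon as all prefix sums of its coefficients are, and the
-- coefficients are eventually periodic. For real sizes, the argument is applied
-- to slightly perturbed rational approximations.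
module Submission where

open import Defs
open import Data.Bool using (Bool; true; false; if_then_else_)
open import Data.Fin using (Fin; toℕ; fromℕ<)
import Data.Fin as Fin
open import Data.Fin.Patterns using (0F; 1F; 2F; 3F; 4F)
import Data.Fin.Properties as Finₚ
open import Data.Integer using (+_)
open import Data.Nat as ℕ using (ℕ; zero; suc; s≤s; z≤n)
import Data.Nat.Properties as ℕₚ
open import Data.Nat.Induction using (<-rec)
open import Data.Sum using (_⊎_; inj₁; inj₂)
open import Data.Vec using (foldr₁; tabulate)
open import Function using (_∘_; case_of_)
open import Data.Product using (_×_; _,_; proj₁; proj₂; ∃-syntax)
open import Data.Rational as ℚ using (ℚ; 0ℚ; 1ℚ; _/_; _+_; _*_; _-_; _≤_; _<_; _⊔_; _⊓_; _≤?_; _<?_; positive; nonNegative)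
import Data.Rational.Properties as ℚₚ
open import Data.Rational.Solver using (module +-*-Solver)
open import Relation.Binary.PropositionalEquality
open import Relation.Nullary using (Dec; does; yes; no; contradiction)
open import Relation.Nullary.Decidable using (from-yes; dec-true; _×-dec_; map′)
open +-*-Solver

-- Finite rational sums and indicators.

Σ< : ℕ → (ℕ → ℚ) → ℚ
Σ< zero    f = 0ℚ
Σ< (suc n) f = Σ< n f + f n

Σ<-mono : ∀ n {f g} → (∀ j → j ℕ.< n → f j ≤ g j) → Σ< n f ≤ Σ< n g
Σ<-mono zero    h = ℚₚ.≤-refl
Σ<-mono (suc n) h =
  ℚₚ.+-mono-≤ (Σ<-mono n λ j j<n → h j (ℕₚ.m<n⇒m<1+n j<n)) (h n ℕₚ.≤-refl)

Σ<-+ : ∀ n f g → Σ< n (λ j → f j + g j) ≡ Σ< n f + Σ< n g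
Σ<-+ zero    f g = refl
Σ<-+ (suc n) f g = trans (cong (_+ (f n + g n)) (Σ<-+ n f g))
  (solve 4 (λ s t u v → s :+ t :+ (u :+ v) := s :+ u :+ (t :+ v)) refl (Σ< n f) (Σ< n g) (f n) (g n))

Σ<-*ˡ : ∀ n c f → Σ< n (λ j → c * f j) ≡ c * Σ< n f
Σ<-*ˡ zero    c f = sym (ℚₚ.*-zeroʳ c)
Σ<-*ˡ (suc n) c f = trans (cong (_+ c * f n) (Σ<-*ˡ n c f)) (sym (ℚₚ.*-distribˡ-+ c (Σ< n f) (f n)))

Σ<-nonneg : ∀ n {f} → (∀ j → j ℕ.< n → 0ℚ ≤ f j) → 0ℚ ≤ Σ< n f
Σ<-nonneg zero    h = ℚₚ.≤-refl
Σ<-nonneg (suc n) h =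
  ℚₚ.+-mono-≤ (Σ<-nonneg n λ j j<n → h j (ℕₚ.m<n⇒m<1+n j<n)) (h n ℕₚ.≤-refl)

*-nonneg : ∀ {p q} → 0ℚ ≤ p → 0ℚ ≤ q → 0ℚ ≤ p * q
*-nonneg {p} {q} 0≤p 0≤q = subst (_≤ p * q) (ℚₚ.*-zeroʳ p)
  (ℚₚ.*-monoˡ-≤-nonNeg p {{nonNegative 0≤p}} 0≤q)

⟦_≟_⟧ : ∀ {m} → Fin m → Fin m → ℚ
⟦ i ≟ k ⟧ = if does (i Fin.≟ k) then 1ℚ else 0ℚ

⟦≟⟧-nonneg : ∀ {m} (i k : Fin m) → 0ℚ ≤ ⟦ i ≟ k ⟧
⟦≟⟧-nonneg i k with does (i Fin.≟ k)
... | true  = from-yes (0ℚ ≤? 1ℚ)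
... | false = ℚₚ.≤-refl

⟦≟⟧-≤1 : ∀ {m} (i k : Fin m) → ⟦ i ≟ k ⟧ ≤ 1ℚ
⟦≟⟧-≤1 i k with does (i Fin.≟ k)
... | true  = ℚₚ.≤-refl
... | false = from-yes (0ℚ ≤? 1ℚ)

-- Dual certificates and nonnegative prefix sums.

-- From here on sequences of job sizes and of coefficients are indexed from 0:
-- index j belongs to job suc j.
δ₁ : ℕ → ℚ
δ₁ 0 = 1ℚ
δ₁ _ = 0ℚ

δ₅₆ : ℕ → ℚ
δ₅₆ 4 = 1ℚ
δ₅₆ 5 = 1ℚ
δ₅₆ _ = 0ℚ

-- Coefficients of the inequality
-- a L_i + b R_k ≤ γ (p₁ + p₂ + …) + α p₁ + β (p₅ + p₆)
-- between the loads L_i and R_k of the first and the second solution.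
record Weights : Set where
  constructor weights
  field a b γ α β : ℕ

⟨_⟩ : ℕ → ℚ
⟨ n ⟩ = + n / 1

-- Dual feasible points of the linear programs maximizing L_i ⊓ R_k.
certificate : Fin 5 → Fin 5 → Weights
certificate 0F _  = weights 10 0 1 9 0
certificate 1F _  = weights 10 0 1 9 0
certificate 2F _  = weights 5 0 1 2 0
certificate _  2F = weights 0 5 1 2 0
certificate _  3F = weights 0 5 1 1 1
certificate _  4F = weights 0 5 1 0 2
-- Only these four pairs combine both loads. Many equal jobs bring `L_i` to 3/2 λ here, while one or
-- two jobs of size λ followed by tiny ones bring `R_k` above 7/5 λ; the two effects exclude each
-- other.
certificate 3F 0F = weights 8 3 3 0 0
certificate 3F 1F = weights 2 2 1 0 0
certificate 4F 0F = weights 10 5 4 1 0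
certificate 4F 1F = weights 5 6 3 0 0

coefficient : Weights → Fin 5 → Fin 5 → ℕ → ℚ
coefficient (weights a b γ α β) i k j =
  ⟨ γ ⟩ + ⟨ α ⟩ * δ₁ j + ⟨ β ⟩ * δ₅₆ j
    - ⟨ a ⟩ * ⟦ machine₁ (suc j) ≟ i ⟧ - ⟨ b ⟩ * ⟦ machine₂ (suc j) ≟ k ⟧

-- The coefficients have period 10 from index 6 on, so prefix sums below 16
-- and the growth over one period decide the sign of all prefix sums.
record Valid (w : Weights) (i k : Fin 5) : Set where
  open Weights w
  field
    a+b-pos  : 0ℚ < ⟨ a ⟩ + ⟨ b ⟩
    -- Bounding the total by 5 λ, and both p₁ and p₅ + p₆ by λ, turns the right-hand side of the
    -- inequality into (5 γ + α + β) λ.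
    ratio    : ⟨ 5 ⟩ * ⟨ γ ⟩ + ⟨ α ⟩ + ⟨ β ⟩ ≤ (⟨ a ⟩ + ⟨ b ⟩) * (+ 7 / 5)
    initial  : ∀ (n : Fin 16) → 0ℚ ≤ Σ< (toℕ n) (coefficient w i k)
    period   : Σ< 6 (coefficient w i k) ≤ Σ< 16 (coefficient w i k)

valid? : ∀ w i k → Dec (Valid w i k)
valid? w i k = map′
  (λ (p , q , r , s) → record { a+b-pos = p ; ratio = q ; initial = r ; period = s })
  (λ v → let open Valid v in a+b-pos , ratio , initial , period)
  (_ <? _ ×-dec _ ≤? _ ×-dec Finₚ.all? (λ n → 0ℚ ≤? Σ< (toℕ n) (coefficient w i k)) ×-dec _ ≤? _)

certificate-valid : ∀ i k → Valid (certificate i k) i k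
certificate-valid = from-yes (Finₚ.all? λ i → Finₚ.all? λ k → valid? (certificate i k) i k)

module _ (i k : Fin 5) where
  private
    w = certificate i k
    c = coefficient w i k
  open Valid (certificate-valid i k)

  -- `c (16 + m)` reduces to `c (6 + m)`: the machines recur with periods 10 and 5, and `δ₁` and
  -- `δ₅₆` vanish there. Each step therefore adds the same number to both sides.
  prefix-periodic : ∀ m → Σ< (6 ℕ.+ m) c ≤ Σ< (16 ℕ.+ m) c
  prefix-periodic zero    = period
  prefix-periodic (suc m) = ℚₚ.+-monoˡ-≤ (c (6 ℕ.+ m)) (prefix-periodic m)

  -- Going back by whole periods of ten ends below 16, where `initial` decides.
  prefix-nonneg : ∀ n → 0ℚ ≤ Σ< n c
  prefix-nonneg = <-rec _ step
    where
    step : ∀ n → (∀ {m} → m ℕ.< n → 0ℚ ≤ Σ< m c) → 0ℚ ≤ Σ< n c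
    step n rec with n ℕ.<? 16
    ... | yes n<16 = subst (λ t → 0ℚ ≤ Σ< t c) (Finₚ.toℕ-fromℕ< n<16) (initial (fromℕ< n<16))
    ... | no  n≮16 = subst (λ t → 0ℚ ≤ Σ< t c) 16+m≡n
      (ℚₚ.≤-trans (rec (subst (6 ℕ.+ m ℕ.<_) 16+m≡n (ℕₚ.m<n+m (6 ℕ.+ m) {10} (s≤s z≤n))))
                  (prefix-periodic m))
      where
      m = n ℕ.∸ 16
      16+m≡n = ℕₚ.m+[n∸m]≡n (ℕₚ.≮⇒≥ n≮16)

-- Rational sizes: Abel summation and lower bounds on the optimum.

record Sizes (N : ℕ) : Set where
  field
    x          : ℕ → ℚ
    x-antitone : ∀ {i j} → i ℕ.≤ j → j ℕ.< N → x j ≤ x i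
    x-nonneg   : ∀ {j} → j ℕ.< N → 0ℚ ≤ x j

open Sizes

loadℚ : ∀ {m} (n : ℕ) → (ℕ → ℚ) → (ℕ → Fin m) → Fin m → ℚ
loadℚ n x a i = Σ< n (λ j → ⟦ a (suc j) ≟ i ⟧ * x j)

-- Abel summation. `go` compares the sum with the current prefix sum of `w` times the latest size:
-- passing to the next, smaller size can only lower this product, because the prefix sum is
-- nonnegative.
abel-nonneg : ∀ {N} (s : Sizes N) (w : ℕ → ℚ) → (∀ n → 0ℚ ≤ Σ< n w) → 0ℚ ≤ Σ< N (λ j → w j * x s j)
abel-nonneg {zero}  s w h = ℚₚ.≤-refl
abel-nonneg {suc N} s w h = ℚₚ.≤-trans (*-nonneg (h (suc N)) (x-nonneg s ℕₚ.≤-refl)) (go N ℕₚ.≤-refl)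
  where
  open ℚₚ.≤-Reasoning
  go : ∀ n → n ℕ.< suc N → Σ< (suc n) w * x s n ≤ Σ< (suc n) (λ j → w j * x s j)
  go zero    _ = ℚₚ.≤-reflexive
    (solve 2 (λ w x → (con 0ℚ :+ w) :* x := con 0ℚ :+ w :* x) refl (w 0) (x s 0))
  go (suc n) n< = begin
    (Σ< (suc n) w + w (suc n)) * x s (suc n)
      ≡⟨ ℚₚ.*-distribʳ-+ (x s (suc n)) (Σ< (suc n) w) (w (suc n)) ⟩
    Σ< (suc n) w * x s (suc n) + w (suc n) * x s (suc n)
      ≤⟨ ℚₚ.+-monoˡ-≤ (w (suc n) * x s (suc n)) (ℚₚ.≤-trans
           (ℚₚ.*-monoˡ-≤-nonNeg (Σ< (suc n) w) {{nonNegative (h (suc n))}}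
             (x-antitone s (ℕₚ.n≤1+n n) n<))
           (go n (ℕₚ.<⇒≤ n<))) ⟩
    Σ< (suc n) (λ j → w j * x s j) + w (suc n) * x s (suc n) ∎

⟦≟⟧-refl : ∀ {m} (i : Fin m) → ⟦ i ≟ i ⟧ ≡ 1ℚ
⟦≟⟧-refl i rewrite dec-true (i Fin.≟ i) refl = refl

Σ<-loads : ∀ n x (a : ℕ → Fin 5) → Σ< n x ≡
  loadℚ n x a 0F + loadℚ n x a 1F + loadℚ n x a 2F + loadℚ n x a 3F + loadℚ n x a 4F
Σ<-loads zero    x a = refl
Σ<-loads (suc n) x a = trans (cong₂ _+_ (Σ<-loads n x a) (split (a (suc n))))
  (solve 10 (λ p q r s t p′ q′ r′ s′ t′ →
      p :+ q :+ r :+ s :+ t :+ (p′ :+ q′ :+ r′ :+ s′ :+ t′) :=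
      p :+ p′ :+ (q :+ q′) :+ (r :+ r′) :+ (s :+ s′) :+ (t :+ t′)) refl
    (loadℚ n x a 0F) (loadℚ n x a 1F) (loadℚ n x a 2F) (loadℚ n x a 3F) (loadℚ n x a 4F)
    (⟦ a (suc n) ≟ 0F ⟧ * x n) (⟦ a (suc n) ≟ 1F ⟧ * x n) (⟦ a (suc n) ≟ 2F ⟧ * x n)
    (⟦ a (suc n) ≟ 3F ⟧ * x n) (⟦ a (suc n) ≟ 4F ⟧ * x n))
  where
  split : ∀ i → x n ≡ ⟦ i ≟ 0F ⟧ * x n + ⟦ i ≟ 1F ⟧ * x n + ⟦ i ≟ 2F ⟧ * x n
                        + ⟦ i ≟ 3F ⟧ * x n + ⟦ i ≟ 4F ⟧ * x n
  split 0F = solve 1 (λ y → y := con 1ℚ :* y :+ con 0ℚ :* y :+ con 0ℚ :* y :+ con 0ℚ :* y :+ con 0ℚ :* y) refl (x n)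
  split 1F = solve 1 (λ y → y := con 0ℚ :* y :+ con 1ℚ :* y :+ con 0ℚ :* y :+ con 0ℚ :* y :+ con 0ℚ :* y) refl (x n)
  split 2F = solve 1 (λ y → y := con 0ℚ :* y :+ con 0ℚ :* y :+ con 1ℚ :* y :+ con 0ℚ :* y :+ con 0ℚ :* y) refl (x n)
  split 3F = solve 1 (λ y → y := con 0ℚ :* y :+ con 0ℚ :* y :+ con 0ℚ :* y :+ con 1ℚ :* y :+ con 0ℚ :* y) refl (x n)
  split 4F = solve 1 (λ y → y := con 0ℚ :* y :+ con 0ℚ :* y :+ con 0ℚ :* y :+ con 0ℚ :* y :+ con 1ℚ :* y) refl (x n)

Σ<-δ₁ : ∀ n (x : ℕ → ℚ) → Σ< (suc n) (λ j → δ₁ j * x j) ≡ x 0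
Σ<-δ₁ zero    x = trans (ℚₚ.+-identityˡ (1ℚ * x 0)) (ℚₚ.*-identityˡ (x 0))
Σ<-δ₁ (suc n) x = trans (cong₂ _+_ (Σ<-δ₁ n x) (ℚₚ.*-zeroˡ (x (suc n)))) (ℚₚ.+-identityʳ (x 0))

Σ<-δ₅₆ : ∀ n (x : ℕ → ℚ) → Σ< (6 ℕ.+ n) (λ j → δ₅₆ j * x j) ≡ x 4 + x 5
Σ<-δ₅₆ zero    x = solve 6 (λ a b c d e f →
    con 0ℚ :+ con 0ℚ :* a :+ con 0ℚ :* b :+ con 0ℚ :* c :+ con 0ℚ :* d :+ con 1ℚ :* e :+ con 1ℚ :* f
      := e :+ f) refl (x 0) (x 1) (x 2) (x 3) (x 4) (x 5)
Σ<-δ₅₆ (suc n) x = trans (cong₂ _+_ (Σ<-δ₅₆ n x) (ℚₚ.*-zeroˡ (x (6 ℕ.+ n)))) (ℚₚ.+-identityʳ (x 4 + x 5))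

module _ {N} (s : Sizes N) {m} (a : ℕ → Fin m) where

  term-nonneg : ∀ i {j} → j ℕ.< N → 0ℚ ≤ ⟦ a (suc j) ≟ i ⟧ * x s j
  term-nonneg i j<N = *-nonneg (⟦≟⟧-nonneg (a (suc _)) i) (x-nonneg s j<N)

  own-term : ∀ {i} j → a (suc j) ≡ i → x s j ≡ ⟦ a (suc j) ≟ i ⟧ * x s j
  own-term j refl = sym (trans (cong (_* x s j) (⟦≟⟧-refl (a (suc j)))) (ℚₚ.*-identityˡ (x s j)))

  loadℚ-nonneg : ∀ i n → n ℕ.≤ N → 0ℚ ≤ loadℚ n (x s) a i
  loadℚ-nonneg i n n≤N = Σ<-nonneg n λ j j<n → term-nonneg i (ℕₚ.<-≤-trans j<n n≤N)

  job≤load : ∀ {i} j n → n ℕ.≤ N → j ℕ.< n → a (suc j) ≡ i → x s j ≤ loadℚ n (x s) a i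
  job≤load {i} j (suc n) n<N j< eq with ℕₚ.m<1+n⇒m<n∨m≡n j<
  ... | inj₁ j<n  = subst (_≤ loadℚ (suc n) (x s) a i) (ℚₚ.+-identityʳ (x s j))
    (ℚₚ.+-mono-≤ (job≤load j n (ℕₚ.<⇒≤ n<N) j<n eq) (term-nonneg i n<N))
  ... | inj₂ refl = subst (_≤ loadℚ (suc n) (x s) a i) (ℚₚ.+-identityˡ (x s j))
    (ℚₚ.+-mono-≤ (loadℚ-nonneg i n (ℕₚ.<⇒≤ n<N)) (ℚₚ.≤-reflexive (own-term j eq)))

  two-jobs≤load : ∀ {i} j k n → n ℕ.≤ N → j ℕ.< k → k ℕ.< n → a (suc j) ≡ i → a (suc k) ≡ i →
    x s j + x s k ≤ loadℚ n (x s) a i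
  two-jobs≤load {i} j k (suc n) n<N j<k k< eqⱼ eqₖ with ℕₚ.m<1+n⇒m<n∨m≡n k<
  ... | inj₁ k<n  = subst (_≤ loadℚ (suc n) (x s) a i) (ℚₚ.+-identityʳ (x s j + x s k))
    (ℚₚ.+-mono-≤ (two-jobs≤load j k n (ℕₚ.<⇒≤ n<N) j<k k<n eqⱼ eqₖ) (term-nonneg i n<N))
  ... | inj₂ refl = ℚₚ.+-mono-≤ (job≤load j n (ℕₚ.<⇒≤ n<N) j<k eqⱼ)
    (ℚₚ.≤-reflexive (own-term k eqₖ))

δ₁-bound : ∀ {N} (s : Sizes N) {m} (a : ℕ → Fin (suc m)) {T} → (∀ i → loadℚ N (x s) a i ≤ T) →
  Σ< N (λ j → δ₁ j * x s j) ≤ T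
-- Without jobs both sums reduce to 0, so any machine serves.
δ₁-bound {zero}  s a h = h 0F
δ₁-bound {suc N} s a h = ℚₚ.≤-trans (ℚₚ.≤-reflexive (Σ<-δ₁ N (x s)))
  (ℚₚ.≤-trans (job≤load s a 0 (suc N) ℕₚ.≤-refl (s≤s z≤n) refl) (h (a 1)))

-- By the pigeonhole principle two of the first six jobs share a machine. Their indices satisfy j <
-- k ≤ 5, hence j ≤ 4, so they are at least as large as jobs 5 and 6 respectively.
δ₅₆-bound : ∀ {N} (s : Sizes N) (a : ℕ → Fin 5) {T} → (∀ i → loadℚ N (x s) a i ≤ T) →
  Σ< N (λ j → δ₅₆ j * x s j) ≤ T
δ₅₆-bound {N} s a {T} h with N ℕ.≤? 5
-- With at most five jobs only job 5 can contribute, and the load of its own machine covers it.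
... | yes N≤5 = ℚₚ.≤-trans (Σ<-mono N λ j j<N →
        ℚₚ.*-monoʳ-≤-nonNeg (x s j) {{nonNegative (x-nonneg s j<N)}} (δ₅₆≤ j (ℕₚ.≤-trans j<N N≤5)))
      (h (a 5))
  where
  δ₅₆≤ : ∀ j → j ℕ.< 5 → δ₅₆ j ≤ ⟦ a (suc j) ≟ a 5 ⟧
  δ₅₆≤ 0 _ = ⟦≟⟧-nonneg (a 1) (a 5)
  δ₅₆≤ 1 _ = ⟦≟⟧-nonneg (a 2) (a 5)
  δ₅₆≤ 2 _ = ⟦≟⟧-nonneg (a 3) (a 5)
  δ₅₆≤ 3 _ = ⟦≟⟧-nonneg (a 4) (a 5)
  δ₅₆≤ 4 _ = ℚₚ.≤-reflexive (sym (⟦≟⟧-refl (a 5)))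
  δ₅₆≤ (suc (suc (suc (suc (suc j))))) j< = contradiction j< (ℕₚ.m+n≮m 5 j)
... | no N≰5
  with M , refl ← ℕₚ.m≤n⇒∃[o]m+o≡n (ℕₚ.≰⇒> N≰5)
     | j , k , j<k , eq ← Finₚ.pigeonhole (ℕₚ.≤-refl {6}) (λ j → a (suc (toℕ j)))
  = begin
  Σ< (6 ℕ.+ M) (λ j → δ₅₆ j * x s j)
    ≡⟨ Σ<-δ₅₆ M (x s) ⟩
  x s 4 + x s 5
    ≤⟨ ℚₚ.+-mono-≤ (x-antitone s (ℕ.s≤s⁻¹ (ℕₚ.<-≤-trans j<k k≤5)) (ℕₚ.m≤m+n 5 (suc M)))
                   (x-antitone s k≤5 (ℕₚ.m≤m+n 6 M)) ⟩
  x s (toℕ j) + x s (toℕ k)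
    ≤⟨ two-jobs≤load s a (toℕ j) (toℕ k) (6 ℕ.+ M) ℕₚ.≤-refl j<k
         (ℕₚ.<-≤-trans (Finₚ.toℕ<n k) (ℕₚ.m≤m+n 6 M)) eq refl ⟩
  loadℚ (6 ℕ.+ M) (x s) a (a (suc (toℕ k)))
    ≤⟨ h (a (suc (toℕ k))) ⟩
  T ∎
  where
  open ℚₚ.≤-Reasoning
  k≤5 : toℕ k ℕ.≤ 5
  k≤5 = ℕ.s≤s⁻¹ (Finₚ.toℕ<n k)

-- Weak duality for a pair of machines.

-- Once `abel-nonneg` shows that the first sum is nonnegative, this identity becomes the inequality
-- for which `Weights` holds the coefficients.
Σ<-coefficient : ∀ w i k n (x : ℕ → ℚ) → let open Weights w in
  Σ< n (λ j → coefficient w i k j * x j) + (⟨ a ⟩ * loadℚ n x machine₁ i + ⟨ b ⟩ * loadℚ n x machine₂ k)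
    ≡ ⟨ γ ⟩ * Σ< n x + ⟨ α ⟩ * Σ< n (λ j → δ₁ j * x j) + ⟨ β ⟩ * Σ< n (λ j → δ₅₆ j * x j)
Σ<-coefficient w i k zero x = solve 5
  (λ a b γ α β → con 0ℚ :+ (a :* con 0ℚ :+ b :* con 0ℚ) :=
    γ :* con 0ℚ :+ α :* con 0ℚ :+ β :* con 0ℚ) refl ⟨ a ⟩ ⟨ b ⟩ ⟨ γ ⟩ ⟨ α ⟩ ⟨ β ⟩
  where open Weights w
Σ<-coefficient w i k (suc n) x = begin
  C + c * y + (⟨ a ⟩ * (L + l * y) + ⟨ b ⟩ * (R + r * y))
    ≡⟨ solve 13 (λ a b γ α β C L R d e l r y →
         C :+ (γ :+ α :* d :+ β :* e :- a :* l :- b :* r) :* y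
           :+ (a :* (L :+ l :* y) :+ b :* (R :+ r :* y)) :=
         C :+ (a :* L :+ b :* R) :+ (γ :+ α :* d :+ β :* e) :* y)
         refl ⟨ a ⟩ ⟨ b ⟩ ⟨ γ ⟩ ⟨ α ⟩ ⟨ β ⟩ C L R (δ₁ n) (δ₅₆ n) l r y ⟩
  C + (⟨ a ⟩ * L + ⟨ b ⟩ * R) + g * y
    ≡⟨ cong (_+ g * y) (Σ<-coefficient w i k n x) ⟩
  ⟨ γ ⟩ * S + ⟨ α ⟩ * D + ⟨ β ⟩ * E + g * y
    ≡⟨ solve 9 (λ γ α β S D E d e y →
         γ :* S :+ α :* D :+ β :* E :+ (γ :+ α :* d :+ β :* e) :* y :=
         γ :* (S :+ y) :+ α :* (D :+ d :* y) :+ β :* (E :+ e :* y))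
         refl ⟨ γ ⟩ ⟨ α ⟩ ⟨ β ⟩ S D E (δ₁ n) (δ₅₆ n) y ⟩
  ⟨ γ ⟩ * (S + y) + ⟨ α ⟩ * (D + δ₁ n * y) + ⟨ β ⟩ * (E + δ₅₆ n * y) ∎
  where
  open Weights w
  open ≡-Reasoning
  c = coefficient w i k n
  C = Σ< n (λ j → coefficient w i k j * x j)
  L = loadℚ n x machine₁ i
  R = loadℚ n x machine₂ k
  l = ⟦ machine₁ (suc n) ≟ i ⟧
  r = ⟦ machine₂ (suc n) ≟ k ⟧
  g = ⟨ γ ⟩ + ⟨ α ⟩ * δ₁ n + ⟨ β ⟩ * δ₅₆ n
  S = Σ< n x
  D = Σ< n (λ j → δ₁ j * x j)
  E = Σ< n (λ j → δ₅₆ j * x j)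
  y = x n

⟨⟩-nonneg : ∀ n → 0ℚ ≤ ⟨ n ⟩
⟨⟩-nonneg n = ℚₚ.nonNegative⁻¹ ⟨ n ⟩ {{ℚₚ.normalize-nonNeg n 1}}

⟨⟩-mono : ∀ n {p q} → p ≤ q → ⟨ n ⟩ * p ≤ ⟨ n ⟩ * q
⟨⟩-mono n = ℚₚ.*-monoˡ-≤-nonNeg ⟨ n ⟩ {{nonNegative (⟨⟩-nonneg n)}}

module _ {N} (s : Sizes N) (a : ℕ → Fin 5) {T} (a≤T : ∀ i → loadℚ N (x s) a i ≤ T) where
  open ℚₚ.≤-Reasoning

  total-bound : Σ< N (x s) ≤ ⟨ 5 ⟩ * T
  total-bound = begin
    Σ< N (x s)           ≡⟨ Σ<-loads N (x s) a ⟩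
    _                    ≤⟨ ℚₚ.+-mono-≤ (ℚₚ.+-mono-≤ (ℚₚ.+-mono-≤ (ℚₚ.+-mono-≤
                              (a≤T 0F) (a≤T 1F)) (a≤T 2F)) (a≤T 3F)) (a≤T 4F) ⟩
    T + T + T + T + T    ≡⟨ solve 1 (λ t → t :+ t :+ t :+ t :+ t := con ⟨ 5 ⟩ :* t) refl T ⟩
    ⟨ 5 ⟩ * T            ∎

  -- A minimum is at most every weighted mean, here the one with the weights of the certificate. `T`
  -- may come from any assignment, so no optimal one has to be known.
  pair-bound : ∀ i k → loadℚ N (x s) machine₁ i ⊓ loadℚ N (x s) machine₂ k ≤ + 7 / 5 * T
  pair-bound i k = ℚₚ.*-cancelˡ-≤-pos (⟨ wₐ ⟩ + ⟨ b ⟩) {{positive a+b-pos}} (begin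
    (⟨ wₐ ⟩ + ⟨ b ⟩) * (L ⊓ R)
      ≡⟨ ℚₚ.*-distribʳ-+ (L ⊓ R) ⟨ wₐ ⟩ ⟨ b ⟩ ⟩
    ⟨ wₐ ⟩ * (L ⊓ R) + ⟨ b ⟩ * (L ⊓ R)
      ≤⟨ ℚₚ.+-mono-≤ (⟨⟩-mono wₐ (ℚₚ.p⊓q≤p L R)) (⟨⟩-mono b (ℚₚ.p⊓q≤q L R)) ⟩
    ⟨ wₐ ⟩ * L + ⟨ b ⟩ * R
      ≡⟨ sym (ℚₚ.+-identityˡ (⟨ wₐ ⟩ * L + ⟨ b ⟩ * R)) ⟩
    0ℚ + (⟨ wₐ ⟩ * L + ⟨ b ⟩ * R)
      ≤⟨ ℚₚ.+-monoˡ-≤ (⟨ wₐ ⟩ * L + ⟨ b ⟩ * R) (abel-nonneg s (coefficient w i k) (prefix-nonneg i k)) ⟩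
    Σ< N (λ j → coefficient w i k j * x s j) + (⟨ wₐ ⟩ * L + ⟨ b ⟩ * R)
      ≡⟨ Σ<-coefficient w i k N (x s) ⟩
    ⟨ γ ⟩ * Σ< N (x s) + ⟨ α ⟩ * Σ< N (λ j → δ₁ j * x s j) + ⟨ β ⟩ * Σ< N (λ j → δ₅₆ j * x s j)
      ≤⟨ ℚₚ.+-mono-≤ (ℚₚ.+-mono-≤ (⟨⟩-mono γ total-bound)
           (⟨⟩-mono α (δ₁-bound s a a≤T))) (⟨⟩-mono β (δ₅₆-bound s a a≤T)) ⟩
    ⟨ γ ⟩ * (⟨ 5 ⟩ * T) + ⟨ α ⟩ * T + ⟨ β ⟩ * T
      ≡⟨ solve 4 (λ γ α β T → γ :* (con ⟨ 5 ⟩ :* T) :+ α :* T :+ β :* T :=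
           (con ⟨ 5 ⟩ :* γ :+ α :+ β) :* T) refl ⟨ γ ⟩ ⟨ α ⟩ ⟨ β ⟩ T ⟩
    (⟨ 5 ⟩ * ⟨ γ ⟩ + ⟨ α ⟩ + ⟨ β ⟩) * T
      ≤⟨ ℚₚ.*-monoʳ-≤-nonNeg T {{nonNegative 0≤T}} ratio ⟩
    (⟨ wₐ ⟩ + ⟨ b ⟩) * (+ 7 / 5) * T
      ≡⟨ ℚₚ.*-assoc (⟨ wₐ ⟩ + ⟨ b ⟩) (+ 7 / 5) T ⟩
    (⟨ wₐ ⟩ + ⟨ b ⟩) * (+ 7 / 5 * T) ∎)
    where
    w = certificate i k
    open Weights w renaming (a to wₐ)
    open Valid (certificate-valid i k)
    L = loadℚ N (x s) machine₁ i
    R = loadℚ N (x s) machine₂ k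
    0≤T : 0ℚ ≤ T
    0≤T = ℚₚ.≤-trans (loadℚ-nonneg s a 0F N ℕₚ.≤-refl) (a≤T 0F)

-- From real numbers to stages of their Cauchy sequences.

-- Which real is extremal is undecidable, but at a fixed stage the terms are rationals and one of
-- them can be picked. The operation is either `_⊔ᵣ_` or `_⊓ᵣ_`.
selected : (_⊕_ : ℝ → ℝ → ℝ) (t : ℕ) →
  (∀ y z → seq (y ⊕ z) t ≡ seq y t ⊎ seq (y ⊕ z) t ≡ seq z t) →
  ∀ {m} (f : Fin (suc m) → ℝ) → ∃[ i ] seq (foldr₁ _⊕_ (tabulate f)) t ≡ seq (f i) t
selected _⊕_ t sel {zero}  f = 0F , refl
selected _⊕_ t sel {suc m} f
  with sel (f 0F) (foldr₁ _⊕_ (tabulate (f ∘ Fin.suc))) | selected _⊕_ t sel (f ∘ Fin.suc)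
... | inj₁ eq | _      = 0F , eq
... | inj₂ eq | i , eq′ = Fin.suc i , trans eq eq′

≤-maximum : ∀ t {m} (f : Fin (suc m) → ℝ) i → seq (f i) t ≤ seq (foldr₁ _⊔ᵣ_ (tabulate f)) t
≤-maximum t {zero}  f 0F          = ℚₚ.≤-refl
≤-maximum t {suc m} f 0F          = ℚₚ.p≤p⊔q (seq (f 0F) t) _
≤-maximum t {suc m} f (Fin.suc i) =
  ℚₚ.≤-trans (≤-maximum t (f ∘ Fin.suc) i) (ℚₚ.p≤q⊔p (seq (f 0F) t) _)

module _ (p : Realization) where

  sizeAt : ℕ → ℕ → ℚ
  sizeAt t j = seq (size p (suc j)) t

  partialLoad-seq : ∀ {m} (s : Solution m) (a : ℕ → Fin m) → (∀ j → machine s (suc j) ≡ a (suc j)) →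
    ∀ i n t → seq (partialLoad p s i n) t ≡ loadℚ n (sizeAt t) a i
  partialLoad-seq s a eq i zero    t = refl
  partialLoad-seq s a eq i (suc n) t = cong₂ _+_ (partialLoad-seq s a eq i n t)
    (trans (cong (λ k → seq (if does (k Fin.≟ i) then size p (suc n) else 0ᵣ) t) (eq n))
           (pick (does (a (suc n) Fin.≟ i))))
    where
    pick : ∀ b → seq (if b then size p (suc n) else 0ᵣ) t ≡ (if b then 1ℚ else 0ℚ) * sizeAt t n
    pick true  = sym (ℚₚ.*-identityˡ (sizeAt t n))
    pick false = sym (ℚₚ.*-zeroˡ (sizeAt t n))

  completionTime-seq : ∀ {m} (s : Solution (suc m)) (a : ℕ → Fin (suc m)) →
    (∀ j → machine s (suc j) ≡ a (suc j)) →
    ∀ t → ∃[ i ] seq (completionTime p s) t ≡ loadℚ (support p) (sizeAt t) a i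
  completionTime-seq s a eq t
    with i , eq′ ← selected _⊔ᵣ_ t (λ y z → ℚₚ.⊔-sel (seq y t) (seq z t)) (load p s) =
    i , trans eq′ (partialLoad-seq s a eq i (support p) t)

  module _ (k : ℕ) where
    open OptimalTimeExists k p

    -- The assignment found depends on the stage `t`; no single one is claimed to attain the real
    -- minimum.
    best-attained : ∀ t n (a : ℕ → Fin (suc k)) →
      ∃[ a′ ] seq (best n a) t ≡ seq (completionTime p (fromAssignment {suc k} a′)) t
    best-attained t zero    a = a , refl
    best-attained t (suc n) a
      with i , eq ← selected _⊓ᵣ_ t (λ y z → ℚₚ.⊓-sel (seq y t) (seq z t))
                      (λ i → best n (update a (suc n) i))
      with a′ , eq′ ← best-attained t n (update a (suc n) i) = a′ , trans eq eq′

    -- The constructed minimum is below all completion times, hence below `opt`, the greatest such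
    -- bound. So from one stage on it exceeds `opt` by at most `η`, and at each stage some
    -- assignment attains it.
    near-optimal : ∀ opt → IsOptimalTime k p opt → ∀ η → 0ℚ < η →
      ∃[ M ] (∀ t → M ℕ.≤ t → ∃[ a ] (∀ i → loadℚ (support p) (sizeAt t) a i ≤ seq opt t + η))
    near-optimal opt (_ , greatest) η 0<η
      with M , h ← greatest (proj₁ optimalTime-exists) (proj₁ (proj₂ optimalTime-exists)) η 0<η =
      M , λ t M≤t → let (a , eq) = best-attained t (support p) (λ _ → 0F) in
        a , λ i → ℚₚ.≤-trans (ℚₚ.≤-reflexive
              (sym (partialLoad-seq (fromAssignment a) a (λ _ → refl) i (support p) t)))
            (ℚₚ.≤-trans (≤-maximum t (load p (fromAssignment a)) i)
              (ℚₚ.≤-trans (ℚₚ.≤-reflexive (sym eq)) (h t M≤t)))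

-- Common stages and repaired sizes.

eventually-∀< : ∀ {P : ℕ → ℕ → Set} → (∀ j → ∃[ M ] (∀ t → M ℕ.≤ t → P j t)) →
  ∀ n → ∃[ M ] (∀ t → M ℕ.≤ t → ∀ j → j ℕ.< n → P j t)
eventually-∀< h zero    = 0 , λ _ _ _ ()
eventually-∀< {P} h (suc n) with M , f ← eventually-∀< {P} h n | K , g ← h n =
  M ℕ.⊔ K , λ t M⊔K≤t j j<1+n → case ℕₚ.m<1+n⇒m<n∨m≡n j<1+n of λ where
    (inj₁ j<n)  → f t (ℕₚ.m⊔n≤o⇒m≤o M K M⊔K≤t) j j<n
    (inj₂ refl) → g t (ℕₚ.m⊔n≤o⇒n≤o M K M⊔K≤t)

count : ℕ → ℚ
count zero    = 0ℚ
count (suc n) = count n + 1ℚ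

count-nonneg : ∀ n → 0ℚ ≤ count n
count-nonneg zero    = ℚₚ.≤-refl
count-nonneg (suc n) = ℚₚ.+-mono-≤ (count-nonneg n) (from-yes (0ℚ ≤? 1ℚ))

-- This is N (N + 1) / 2, the sum of all shifts made by `Repair` in units of `η`.
excess : ℕ → ℚ
excess N = Σ< N (λ j → count (N ℕ.∸ j))

antitone-from-step : ∀ {N} (x : ℕ → ℚ) → (∀ j → suc j ℕ.< N → x (suc j) ≤ x j) →
  ∀ {i j} → i ℕ.≤ j → j ℕ.< N → x j ≤ x i
antitone-from-step x h {j = zero}  z≤n _ = ℚₚ.≤-refl
antitone-from-step x h {j = suc j} i≤1+j 1+j<N with ℕₚ.m≤n⇒m<n∨m≡n i≤1+j
... | inj₁ (s≤s i≤j) = ℚₚ.≤-trans (h j 1+j<N) (antitone-from-step x h i≤j (ℕₚ.<⇒≤ 1+j<N))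
... | inj₂ refl      = ℚₚ.≤-refl

-- At a fixed stage of the Cauchy sequences the sizes are decreasing and
-- nonnegative only up to η; adding (N - j) η to the j-th size repairs both.
module Repair {N} (y : ℕ → ℚ) (η : ℚ) (0<η : 0ℚ < η)
  (step : ∀ j → j ℕ.< N → y (suc j) ≤ y j + η) (lower : ∀ j → j ℕ.< N → 0ℚ ≤ y j + η) where

  shift : ℕ → ℚ
  shift j = η * count (N ℕ.∸ j)

  private
    shift-step : ∀ {j} → j ℕ.< N → shift j ≡ η + shift (suc j)
    shift-step {j} j<N = trans (cong (λ n → η * count n) (ℕₚ.+-∸-assoc 1 j<N))
      (solve 2 (λ e c → e :* (c :+ con 1ℚ) := e :+ e :* c) refl η (count (N ℕ.∸ suc j)))

    shift-nonneg : ∀ j → 0ℚ ≤ shift j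
    shift-nonneg j = *-nonneg (ℚₚ.<⇒≤ 0<η) (count-nonneg (N ℕ.∸ j))

    shift-assoc : ∀ {j} → j ℕ.< N → y j + η + shift (suc j) ≡ y j + shift j
    shift-assoc {j} j<N =
      trans (ℚₚ.+-assoc (y j) η (shift (suc j))) (cong (λ z → y j + z) (sym (shift-step j<N)))

  sizes : Sizes N
  sizes = record
    { x          = λ j → y j + shift j
    ; x-antitone = antitone-from-step (λ j → y j + shift j) λ j 1+j<N → let j<N = ℕₚ.<⇒≤ 1+j<N in
        subst (y (suc j) + shift (suc j) ≤_) (shift-assoc j<N)
          (ℚₚ.+-monoˡ-≤ (shift (suc j)) (step j j<N))
    ; x-nonneg   = λ {j} j<N → subst (0ℚ ≤_) (shift-assoc j<N)
        (ℚₚ.+-mono-≤ (lower j j<N) (shift-nonneg (suc j)))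
    }

  module _ {m} (a : ℕ → Fin m) (i : Fin m) where

    ≤-repaired : loadℚ N y a i ≤ loadℚ N (x sizes) a i
    ≤-repaired = Σ<-mono N λ j _ → ℚₚ.*-monoˡ-≤-nonNeg ⟦ a (suc j) ≟ i ⟧
      {{nonNegative (⟦≟⟧-nonneg (a (suc j)) i)}}
      (subst (_≤ y j + shift j) (ℚₚ.+-identityʳ (y j)) (ℚₚ.+-monoʳ-≤ (y j) (shift-nonneg j)))

    -- At worst all shifts fall on one machine. The resulting error is the same for every
    -- assignment, which matters as the near-optimal one varies with the stage.
    repaired-≤ : loadℚ N (x sizes) a i ≤ loadℚ N y a i + η * excess N
    repaired-≤ = begin
      loadℚ N (x sizes) a i
        ≤⟨ Σ<-mono N (λ j _ → pointwise j) ⟩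
      Σ< N (λ j → ⟦ a (suc j) ≟ i ⟧ * y j + shift j)
        ≡⟨ Σ<-+ N (λ j → ⟦ a (suc j) ≟ i ⟧ * y j) shift ⟩
      loadℚ N y a i + Σ< N shift
        ≡⟨ cong (λ z → loadℚ N y a i + z) (Σ<-*ˡ N η (λ j → count (N ℕ.∸ j))) ⟩
      loadℚ N y a i + η * excess N ∎
      where
      open ℚₚ.≤-Reasoning
      pointwise : ∀ j → ⟦ a (suc j) ≟ i ⟧ * (y j + shift j) ≤ ⟦ a (suc j) ≟ i ⟧ * y j + shift j
      pointwise j = begin
        e * (y j + shift j)       ≡⟨ ℚₚ.*-distribˡ-+ e (y j) (shift j) ⟩
        e * y j + e * shift j     ≤⟨ ℚₚ.+-monoʳ-≤ (e * y j)
                                       (ℚₚ.*-monoʳ-≤-nonNeg (shift j) {{nonNegative (shift-nonneg j)}}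
                                         (⟦≟⟧-≤1 (a (suc j)) i)) ⟩
        e * y j + 1ℚ * shift j    ≡⟨ cong (λ z → e * y j + z) (ℚₚ.*-identityˡ (shift j)) ⟩
        e * y j + shift j         ∎
        where e = ⟦ a (suc j) ≟ i ⟧

-- The competitive ratio for real sizes.

module _ (p : Realization) (opt : ℝ) (isOpt : IsOptimalTime 4 p opt) where
  private
    N = support p
    -- The summand `1ℚ` accounts for near-optimality, `excess N` for the repair of the sizes.
    C = 1ℚ + excess N

  makespan-bound : ∀ η → 0ℚ < η → ∃[ M ] (∀ t → M ℕ.≤ t →
    seq (makespan p fiveMachineAlgorithm) t ≤ + 7 / 5 * (seq opt t + η * C))
  makespan-bound η 0<η
    with K , step ← eventually-∀< {λ j t → sizeAt p t (suc j) ≤ sizeAt p t j + η}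
                      (λ j → decreasing p (s≤s z≤n) (ℕₚ.n≤1+n (suc j)) η 0<η) N
       | L , lower ← eventually-∀< {λ j t → 0ℚ ≤ sizeAt p t j + η}
                      (λ j → nonneg p (s≤s z≤n) η 0<η) N
       | M , near ← near-optimal p 4 opt isOpt η 0<η
    = K ℕ.⊔ L ℕ.⊔ M , λ t t≥ →
      let t≥KL = ℕₚ.m⊔n≤o⇒m≤o (K ℕ.⊔ L) M t≥ in
      bound t (step t (ℕₚ.m⊔n≤o⇒m≤o K L t≥KL)) (lower t (ℕₚ.m⊔n≤o⇒n≤o K L t≥KL))
        (near t (ℕₚ.m⊔n≤o⇒n≤o (K ℕ.⊔ L) M t≥))
    where
    open ℚₚ.≤-Reasoning
    bound : ∀ t → (∀ j → j ℕ.< N → sizeAt p t (suc j) ≤ sizeAt p t j + η) →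
      (∀ j → j ℕ.< N → 0ℚ ≤ sizeAt p t j + η) →
      ∃[ a ] (∀ i → loadℚ N (sizeAt p t) a i ≤ seq opt t + η) →
      seq (makespan p fiveMachineAlgorithm) t ≤ + 7 / 5 * (seq opt t + η * C)
    bound t step lower (a , a≤)
      with i , eq₁ ← completionTime-seq p solution₁ machine₁ (λ _ → refl) t
         | k , eq₂ ← completionTime-seq p solution₂ machine₂ (λ _ → refl) t = begin
      seq (makespan p fiveMachineAlgorithm) t
        ≡⟨ cong₂ _⊓_ eq₁ eq₂ ⟩
      loadℚ N (sizeAt p t) machine₁ i ⊓ loadℚ N (sizeAt p t) machine₂ k
        ≤⟨ ℚₚ.⊓-mono-≤ (≤-repaired machine₁ i) (≤-repaired machine₂ k) ⟩
      loadℚ N (x sizes) machine₁ i ⊓ loadℚ N (x sizes) machine₂ k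
        ≤⟨ pair-bound sizes a (λ i → ℚₚ.≤-trans (repaired-≤ a i)
             (ℚₚ.+-monoˡ-≤ (η * excess N) (a≤ i))) i k ⟩
      + 7 / 5 * (seq opt t + η + η * excess N)
        ≡⟨ cong (λ z → + 7 / 5 * z) (solve 3 (λ o e c →
             o :+ e :+ e :* c := o :+ e :* (con 1ℚ :+ c)) refl (seq opt t) η (excess N)) ⟩
      + 7 / 5 * (seq opt t + η * C) ∎
      where open Repair (sizeAt p t) η 0<η step lower

theorem6 : CompetitiveRatio≤ fiveMachineAlgorithm (fromℚ (+ 7 / 5))
theorem6 p opt isOpt 0<opt ε 0<ε =
  let M , h = makespan-bound p opt isOpt η 0<η in M , λ t M≤t → ratio-bound t (h t M≤t)
  where
  open Inverse opt 0<opt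
  open ℚₚ.≤-Reasoning
  C = 1ℚ + excess (support p)
  0<C : 0ℚ < C
  0<C = ℚₚ.+-mono-<-≤ (from-yes (0ℚ <? 1ℚ)) (Σ<-nonneg (support p) λ j _ → count-nonneg (support p ℕ.∸ j))
  -- `η` is chosen with 7/5 C η = ½ ε δ: since every denominator is at least `δ`, the error stays
  -- below `ε` after the division.
  small = scale {+ 7 / 5 * C} (pos*pos (from-yes (0ℚ <? + 7 / 5)) 0<C) (pos*pos 0<ε 0<δ)
  η = proj₁ small
  0<η = proj₁ (proj₂ small)

  ratio-bound : ∀ t → seq (makespan p fiveMachineAlgorithm) t ≤ + 7 / 5 * (seq opt t + η * C) →
    seq (makespan p fiveMachineAlgorithm) t * inv t ≤ + 7 / 5 + ε
  ratio-bound t h = begin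
    seq (makespan p fiveMachineAlgorithm) t * inv t
      ≤⟨ ℚₚ.*-monoʳ-≤-nonNeg (inv t) {{ℚₚ.pos⇒nonNeg (inv t) {{inv-pos t}}}} (begin
        seq (makespan p fiveMachineAlgorithm) t
          ≤⟨ h ⟩
        + 7 / 5 * (seq opt t + η * C)
          ≡⟨ solve 3 (λ o e c → con (+ 7 / 5) :* (o :+ e :* c) :=
               con (+ 7 / 5) :* o :+ con (+ 7 / 5) :* c :* e) refl (seq opt t) η C ⟩
        + 7 / 5 * seq opt t + + 7 / 5 * C * η
          -- `den t` is the maximum of the term of `opt` and `δ`, so it may replace that term at
          -- every stage.
          ≤⟨ ℚₚ.+-mono-≤ (⟨7/5⟩-mono (ℚₚ.p≤p⊔q (seq opt t) δ)) small-error ⟩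
        + 7 / 5 * den t + ε * den t
          ≡⟨ solve 2 (λ e d → con (+ 7 / 5) :* d :+ e :* d := d :* (con (+ 7 / 5) :+ e)) refl ε (den t) ⟩
        den t * (+ 7 / 5 + ε) ∎) ⟩
    den t * (+ 7 / 5 + ε) * inv t
      ≡⟨ solve 3 (λ d c i → d :* c :* i := d :* i :* c) refl (den t) (+ 7 / 5 + ε) (inv t) ⟩
    den t * inv t * (+ 7 / 5 + ε)
      ≡⟨ cong (_* (+ 7 / 5 + ε)) (den*inv t) ⟩
    1ℚ * (+ 7 / 5 + ε)
      ≡⟨ ℚₚ.*-identityˡ (+ 7 / 5 + ε) ⟩
    + 7 / 5 + ε ∎
    where
    ⟨7/5⟩-mono : ∀ {q r} → q ≤ r → + 7 / 5 * q ≤ + 7 / 5 * r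
    ⟨7/5⟩-mono = ℚₚ.*-monoˡ-≤-nonNeg (+ 7 / 5)
    half = ℚ.½ * (ε * δ)
    small-error : + 7 / 5 * C * η ≤ ε * den t
    small-error = begin
      + 7 / 5 * C * η    ≡⟨ proj₂ (proj₂ small) ⟩
      half               ≡⟨ sym (ℚₚ.+-identityʳ half) ⟩
      half + 0ℚ          ≤⟨ ℚₚ.+-monoʳ-≤ half (ℚₚ.<⇒≤ (half-pos (pos*pos 0<ε 0<δ))) ⟩
      half + half        ≡⟨ half+half (ε * δ) ⟩
      ε * δ              ≤⟨ ℚₚ.*-monoˡ-≤-nonNeg ε {{nonNegative (ℚₚ.<⇒≤ 0<ε)}} (δ≤den t) ⟩
      ε * den t          ∎
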